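{- Let $p>3$ be a prime with $p\equiv 2\pmod 3$, $q=p^k$, and let $E_1,E_2$ be elliptic curves defined over $\mathbb{F}_q$ with $j(E_1)=j(E_2)=0$. Then $\#E_1(\mathbb{F}_q)=\#E_2(\mathbb{F}_q)$ if and only if $E_1(\mathbb{F}_q)\cong E_2(\mathbb{F}_q)$ as groups.
   Context: For $E:y^2=x^3+Ax+B$ the $j$-invariant is $j(E)=1728\cdot\frac{4A^3}{4A^3+27B^2}$; $j(E)=0$ means $E$ has the form $y^2=x^3+B$. $E(\mathbb{F}_q)$ denotes the group of $\mathbb{F}_q$-rational points. -}

module Defs where

open import Level using (0ℓ)
open import Data.Nat using (ℕ; suc)
open import Data.List using (List; length; filter; cartesianProduct)
open import Data.List.Membership.Propositional using (_∈_)
open import Data.List.Relation.Unary.Unique.Propositional using (Unique)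
open import Data.Unit using (⊤)
open import Data.Maybe using (Maybe; just; nothing)
open import Data.Product using (_×_; _,_; Σ; ∃)
open import Relation.Binary.PropositionalEquality using (_≡_; _≢_)
open import Relation.Binary using (DecidableEquality)
open import Relation.Nullary using (Dec; yes; no)
open import Algebra.Structures using (IsCommutativeRing)

record FiniteField : Set₁ where
  infixl 6 _+_ _-_
  infixl 7 _*_
  field
    Carrier  : Set
    _+_ _*_  : Carrier → Carrier → Carrier
    -_       : Carrier → Carrier
    0# 1#    : Carrier
    isCommutativeRing : IsCommutativeRing _≡_ _+_ _*_ -_ 0# 1#
    0≢1      : 0# ≢ 1#
    _⁻¹      : Carrier → Carrier
    inverse  : ∀ x → x ≢ 0# → x * (x ⁻¹) ≡ 1#
    _≟_      : DecidableEquality Carrier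
    elements : List Carrier
    complete : ∀ x → x ∈ elements
    unique   : Unique elements

  _-_ : Carrier → Carrier → Carrier
  x - y = x + (- y)

  size : ℕ
  size = length elements

module Curve (F : FiniteField) where
  open FiniteField F

  2# 3# : Carrier
  2# = 1# + 1#
  3# = 2# + 1#

  -- The curve E_B : y² = x³ + B  (j-invariant 0; nonsingular iff B ≠ 0
  -- in characteristic > 3).
  OnCurve : Carrier → Carrier → Carrier → Set
  OnCurve B x y = y * y ≡ x * x * x + B

  onCurve? : ∀ B x y → Dec (OnCurve B x y)
  onCurve? B x y = (y * y) ≟ (x * x * x + B)

  -- Projective points: nothing = point at infinity O, just (x , y) affine.
  Point : Set
  Point = Maybe (Carrier × Carrier)

  IsPoint : Carrier → Point → Set
  IsPoint B nothing        = ⊤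
  IsPoint B (just (x , y)) = OnCurve B x y

  -- #E_B(F_q) = 1 (point at infinity) + number of affine solutions
  #E : Carrier → ℕ
  #E B = suc (length (filter (λ (xy : Carrier × Carrier) → onCurve? B (Data.Product.proj₁ xy) (Data.Product.proj₂ xy))
                       (cartesianProduct elements elements)))

  -- The chord-and-tangent group law on y² = x³ + B (A = 0).
  addPt : Carrier → Point → Point → Point
  addPt B nothing Q = Q
  addPt B (just P) nothing = just P
  addPt B (just (x₁ , y₁)) (just (x₂ , y₂)) with x₁ ≟ x₂
  ... | no _  = third ((y₂ - y₁) * ((x₂ - x₁) ⁻¹))
    where
      third : Carrier → Point
      third λ′ = let x₃ = λ′ * λ′ - x₁ - x₂ in just (x₃ , λ′ * (x₁ - x₃) - y₁)
  ... | yes _ with y₁ ≟ (- y₂)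
  ...   | yes _ = nothing
  ...   | no _  = third ((3# * x₁ * x₁) * ((2# * y₁) ⁻¹))
    where
      third : Carrier → Point
      third λ′ = let x₃ = λ′ * λ′ - x₁ - x₂ in just (x₃ , λ′ * (x₁ - x₃) - y₁)

  record GroupIso (B₁ B₂ : Carrier) : Set where
    field
      φ         : Point → Point
      preserves : ∀ P → IsPoint B₁ P → IsPoint B₂ (φ P)
      injective : ∀ P Q → IsPoint B₁ P → IsPoint B₁ Q → φ P ≡ φ Q → P ≡ Q
      surjective : ∀ R → IsPoint B₂ R → Σ Point (λ P → IsPoint B₁ P × φ P ≡ R)
      homo      : ∀ P Q → IsPoint B₁ P → IsPoint B₁ Q →
                  φ (addPt B₁ P Q) ≡ addPt B₂ (φ P) (φ Q)

  _≅E_ : Carrier → Carrier → Set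
  B₁ ≅E B₂ = GroupIso B₁ B₂

{-# OPTIONS --safe #-}

-- The case distinction is whether −3 is a square in F, equivalently whether F
-- contains a primitive cube root of unity ω; the parity of k plays no role.
--
-- If it does, the number of points modulo 3 (fibres of y, on which ω acts) tells
-- whether B is a square, and modulo 2 (fibres of x) whether B is a cube. So equal
-- counts give B₂ = u⁶ B₁ or B₂ = u⁶ B₁⁻¹. The first is the scaling
-- (x , y) ↦ (u² x , u³ y). In the second, p ≡ 5 (mod 6) makes B₁^p · B₁ a sixth power,
-- so the Frobenius map (x , y) ↦ (x^p , y^p) reduces it to a scaling.
--
-- If it does not, every element is a cube, so B₁ and B₂ differ by a sixth power
-- unless exactly one of them, say B₁, is a square. Then the 3-isogeny
-- E_B → E_{−27B} at the nonsquare B = B₂ is injective on rational points, and −27B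
-- is a square, hence a sixth power times B₁.
--
-- Every map used here has trivial kernel, so it is injective, and the equality of
-- the point counts makes it bijective.
module Submission where

open import Defs
open import Level using (0ℓ)
open import Algebra.Bundles using (CommutativeRing)
open import Algebra.Solver.Ring.AlmostCommutativeRing
  using (AlmostCommutativeRing; fromCommutativeRing; _-Raw-AlmostCommutative⟶_)
import Algebra.Solver.Ring as RingSolver
open import Data.Fin using (Fin; zero; suc; fromℕ; inject₁)
open import Data.Fin.Properties using (toℕ-fromℕ; toℕ-inject₁; toℕ<n)
open import Data.Integer as ℤ using (ℤ; +_; -[1+_]; +[1+_])
import Data.Integer.Properties as ℤ
open import Data.List using (List; []; _∷_; _++_; length; map; filter; foldr; cartesianProduct)
open import Data.List.Properties using (length-++; length-map; filter-++)
open import Data.List.Membership.Propositional using (_∈_; lose)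
open import Data.List.Membership.Propositional.Properties
  using (∈-∃++; ∈-++⁺ˡ; ∈-++⁺ʳ; ∈-++⁻; ∈-map⁺; ∈-map⁻; ∈-filter⁺; ∈-filter⁻;
         ∈-cartesianProduct⁺; ∈-cartesianProduct⁻)
open import Data.List.Membership.Propositional.Properties.WithK using (unique∧set⇒bag)
open import Data.List.Relation.Binary.BagAndSetEquality using (∼bag⇒↭)
open import Data.List.Relation.Binary.Permutation.Propositional using (_↭_; ↭⇒↭ₛ)
import Data.List.Relation.Binary.Permutation.Setoid.Properties as Permutation
open import Data.List.Relation.Binary.Subset.Propositional using (_⊆_)
open import Data.List.Relation.Unary.All as All using (All; []; _∷_)
open import Data.List.Relation.Unary.AllPairs as AllPairs using (AllPairs; []; _∷_)
open import Data.List.Relation.Unary.Any using (here; there; any?; satisfied)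
open import Data.List.Relation.Unary.Unique.Propositional using (Unique)
import Data.List.Relation.Unary.Unique.Propositional.Properties as Unique
open import Data.Maybe as Maybe using (Maybe; just; nothing)
open import Data.Maybe.Properties using (just-injective; ≡-dec)
open import Data.Nat as ℕ using (zero; suc; _≤_; _<_; z≤n; s≤s)
open import Data.Nat using (ℕ; _^_; _>_; _%_)
import Data.Nat.Properties as ℕ
open import Data.Nat.Combinatorics using (_C_; nCk+nC[k+1]≡[n+1]C[k+1]; nCn≡1; nC1≡n)
open import Data.Nat.DivMod using (m≡m%n+[m/n]*n; m%n<n)
open import Data.Nat.Divisibility
  using (_∣_; divides; _∣?_; >⇒∤; ∣m+n∣m⇒∣n; m∣m*n; m%n≡0⇒n∣m)
open import Data.Nat.Primality using (Prime; euclidsLemma; prime⇒irreducible)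
open import Data.Nat.Solver using (module +-*-Solver)
open import Data.Product using (_×_; _,_; proj₁; proj₂; ∃; swap)
import Data.Product.Properties as Product
open import Data.Sum using (_⊎_; inj₁; inj₂; [_,_]′)
open import Data.Unit using (tt)
open import Function using (_∘_; id; mk⇔)
open import Function.Bundles using (_⇔_)
open import Relation.Binary using (DecidableEquality)
open import Relation.Binary.Definitions using (Symmetric)
open import Relation.Binary.PropositionalEquality as ≡ using (_≡_)
open import Relation.Nullary using (¬_; ¬?; Dec; yes; no; contradiction)
import Relation.Nullary.Decidable as Dec
open import Relation.Unary using (Decidable)
open import Relation.Unary.Properties using (∁?)

-- Homomorphisms are built as `AffineHom`: O goes to O and affine points go to affine points, so the
-- kernel is trivial by construction. Opposite points are dealt with by commuting with negation, and
-- what remains is to send every nonvertical secant or tangent to another one. Injectivity then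
-- rests on the shape of `addPt`, where only opposite points have sum O. With ω the obstacle is that
-- the noncubes form two classes modulo cubes, exchanged by inversion, and no count can separate
-- them: the curves of B and of its inverse are Frobenius conjugates up to a scaling. The same
-- Frobenius therefore has to supply the isomorphism. Without ω only the square class of B is left,
-- and no scaling over F changes it. The constant -27 = 3² · (-3) does, because -3 is itself a
-- nonsquare. The isogeny has to start at the nonsquare side, since for a square B its kernel point
-- (0 , √B) is rational. The class facts come from counting: disjoint cosets of the squares or cubes
-- are too many to fit into the nonzero elements.

-- Polynomial identities with integer constants.

module IntegerCoefficients {c ℓ} (R : CommutativeRing c ℓ) where
  open CommutativeRing R
  open import Algebra.Properties.Ring ring
    using (-0#≈0#; -‿distribˡ-*; -‿distribʳ-*; -‿involutive; -‿+-comm)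
  open import Algebra.Properties.Semiring.Mult.TCOptimised semiring
    using (×-homo-+; ×1-homo-*)
    renaming (_×_ to _·_; 1+× to ×-suc)
  open import Relation.Binary.Reasoning.Setoid setoid

  -- With the optimised multiple, the images of 1, 2 and 3 reduce to `1#` and to the `2#` and `3#`
  -- of the curve, so identities found by the solver apply to the tangent formula as it stands.
  ι : ℤ → Carrier
  ι (+ n)    = n · 1#
  ι -[1+ n ] = - (suc n · 1#)

  ι-neg : ∀ i → ι (ℤ.- i) ≈ - ι i
  ι-neg (+ zero)  = sym -0#≈0#
  ι-neg +[1+ n ]  = refl
  ι-neg -[1+ n ]  = sym (-‿involutive _)

  private
    cancel-1 : ∀ a b → (1# + a) - (1# + b) ≈ a - b
    cancel-1 a b = begin
      (1# + a) + - (1# + b)   ≈⟨ +-cong (+-comm 1# a) (sym (-‿+-comm 1# b)) ⟩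
      (a + 1#) + (- 1# + - b) ≈⟨ +-assoc a 1# _ ⟩
      a + (1# + (- 1# + - b)) ≈⟨ +-congˡ (+-assoc 1# _ _) ⟨
      a + ((1# + - 1#) + - b) ≈⟨ +-congˡ (+-congʳ (-‿inverseʳ 1#)) ⟩
      a + (0# + - b)          ≈⟨ +-congˡ (+-identityˡ _) ⟩
      a - b                   ∎

  ι-⊖ : ∀ m n → ι (m ℤ.⊖ n) ≈ m · 1# - n · 1#
  ι-⊖ zero zero = sym (-‿inverseʳ 0#)
  ι-⊖ zero (suc n) = sym (+-identityˡ _)
  ι-⊖ (suc m) zero = sym (trans (+-congˡ -0#≈0#) (+-identityʳ _))
  ι-⊖ (suc m) (suc n) = begin
    ι (suc m ℤ.⊖ suc n)               ≡⟨ ≡.cong ι (ℤ.[1+m]⊖[1+n]≡m⊖n m n) ⟩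
    ι (m ℤ.⊖ n)                       ≈⟨ ι-⊖ m n ⟩
    m · 1# - n · 1#                   ≈⟨ cancel-1 _ _ ⟨
    (1# + m · 1#) - (1# + n · 1#)     ≈⟨ +-cong (×-suc m 1#) (-‿cong (×-suc n 1#)) ⟨
    suc m · 1# - suc n · 1#           ∎

  ι-+ : ∀ i j → ι (i ℤ.+ j) ≈ ι i + ι j
  ι-+ (+ m) (+ n)       = ×-homo-+ 1# m n
  ι-+ (+ m) -[1+ n ]    = ι-⊖ m (suc n)
  ι-+ -[1+ m ] (+ n)    = trans (ι-⊖ n (suc m)) (+-comm _ _)
  ι-+ -[1+ m ] -[1+ n ] = begin
    ι (-[1+ m ] ℤ.+ -[1+ n ])       ≡⟨ ≡.cong ι (ℤ.neg-distrib-+ +[1+ m ] +[1+ n ]) ⟨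
    - ((suc m ℕ.+ suc n) · 1#)      ≈⟨ -‿cong (×-homo-+ 1# (suc m) (suc n)) ⟩
    - (suc m · 1# + suc n · 1#)     ≈⟨ -‿+-comm _ _ ⟨
    - (suc m · 1#) + - (suc n · 1#) ∎

  ι-*⁺ : ∀ m j → ι (+ m ℤ.* j) ≈ ι (+ m) * ι j
  ι-*⁺ m (+ n) = trans (reflexive (≡.cong ι (≡.sym (ℤ.pos-* m n)))) (×1-homo-* m n)
  ι-*⁺ m -[1+ n ] = begin
    ι (+ m ℤ.* -[1+ n ])       ≡⟨ ≡.cong ι (ℤ.neg-distribʳ-* (+ m) +[1+ n ]) ⟨
    ι (ℤ.- (+ m ℤ.* +[1+ n ])) ≈⟨ ι-neg (+ m ℤ.* +[1+ n ]) ⟩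
    - ι (+ m ℤ.* +[1+ n ])     ≈⟨ -‿cong (ι-*⁺ m +[1+ n ]) ⟩
    - (ι (+ m) * ι +[1+ n ])   ≈⟨ -‿distribʳ-* _ _ ⟩
    ι (+ m) * ι -[1+ n ]       ∎

  ι-* : ∀ i j → ι (i ℤ.* j) ≈ ι i * ι j
  ι-* (+ m) j = ι-*⁺ m j
  ι-* -[1+ m ] j = begin
    ι (-[1+ m ] ℤ.* j)         ≡⟨ ≡.cong ι (ℤ.neg-distribˡ-* +[1+ m ] j) ⟨
    ι (ℤ.- (+[1+ m ] ℤ.* j))   ≈⟨ ι-neg (+[1+ m ] ℤ.* j) ⟩
    - ι (+[1+ m ] ℤ.* j)       ≈⟨ -‿cong (ι-*⁺ (suc m) j) ⟩
    - (ι +[1+ m ] * ι j)       ≈⟨ -‿distribˡ-* _ _ ⟩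
    ι -[1+ m ] * ι j           ∎

  private
    ACR : AlmostCommutativeRing c ℓ
    ACR = fromCommutativeRing R

    ι-morphism : ℤ.+-*-rawRing -Raw-AlmostCommutative⟶ ACR
    ι-morphism = record
      { ⟦_⟧ = ι ; +-homo = ι-+ ; *-homo = ι-* ; -‿homo = ι-neg
      ; 0-homo = refl ; 1-homo = refl }

    _coeff≟_ : ∀ i j → Maybe (ι i ≈ ι j)
    i coeff≟ j with i ℤ.≟ j
    ... | yes i≡j = just (reflexive (≡.cong ι i≡j))
    ... | no _    = nothing

  open RingSolver ℤ.+-*-rawRing ACR ι-morphism _coeff≟_ public
    using (solve; _:=_; _:+_; _:*_; _:-_; :-_; con)

open ≡

-- Counting in finite lists, binomial coefficients and remainders.

module _ where
  open import Data.Nat using (_+_; _*_)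

  private variable
    A B : Set
    xs ys : List A

  Unique-⊆⇒length≤ : Unique xs → xs ⊆ ys → length xs ≤ length ys
  Unique-⊆⇒length≤ {xs = []} [] _ = z≤n
  Unique-⊆⇒length≤ {xs = x ∷ xs} (x∉xs ∷ xs!) sub with ∈-∃++ (sub (here refl))
  ... | us , vs , refl = begin
    suc (length xs)             ≤⟨ s≤s (Unique-⊆⇒length≤ xs! sub′) ⟩
    suc (length (us ++ vs))     ≡⟨ cong suc (length-++ us) ⟩
    suc (length us + length vs) ≡⟨ ℕ.+-suc (length us) (length vs) ⟨
    length us + suc (length vs) ≡⟨ length-++ us ⟨
    length (us ++ x ∷ vs)       ∎
    where
    open ℕ.≤-Reasoning
    sub′ : xs ⊆ us ++ vs
    sub′ z∈xs with ∈-++⁻ us (sub (there z∈xs))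
    ... | inj₁ z∈us         = ∈-++⁺ˡ z∈us
    ... | inj₂ (here refl)  = contradiction refl (All.lookup x∉xs z∈xs)
    ... | inj₂ (there z∈vs) = ∈-++⁺ʳ us z∈vs

  Unique-≡-length : Unique xs → Unique ys → xs ⊆ ys → ys ⊆ xs → length xs ≡ length ys
  Unique-≡-length xs! ys! xs⊆ys ys⊆xs =
    ℕ.≤-antisym (Unique-⊆⇒length≤ xs! xs⊆ys) (Unique-⊆⇒length≤ ys! ys⊆xs)

  module _ (f : A → B) where

    InjectiveOn : List A → Set
    InjectiveOn xs = ∀ {x y} → x ∈ xs → y ∈ xs → f x ≡ f y → x ≡ y

    Unique-map⁺ : InjectiveOn xs → Unique xs → Unique (map f xs)
    Unique-map⁺ {xs = []} inj [] = []
    Unique-map⁺ {xs = x ∷ xs} inj (x∉xs ∷ xs!) =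
      All.tabulate fresh ∷ Unique-map⁺ (λ p q → inj (there p) (there q)) xs!
      where
      fresh : ∀ {y} → y ∈ map f xs → f x ≢ y
      fresh y∈ fx≡y with ∈-map⁻ f y∈
      ... | z , z∈xs , refl = All.lookup x∉xs z∈xs (inj (here refl) (there z∈xs) fx≡y)

    -- A missed y could be put in front of `map f xs`, giving a duplicate-free list inside `ys` that
    -- is longer than `ys`.
    injectiveOn⇒surjectiveOn : DecidableEquality B → Unique xs → InjectiveOn xs →
      (∀ {x} → x ∈ xs → f x ∈ ys) → length ys ≤ length xs →
      ∀ {y} → y ∈ ys → ∃ λ x → x ∈ xs × y ≡ f x
    injectiveOn⇒surjectiveOn {xs = xs} {ys = ys} _≟_ xs! inj into bound {y} y∈ys with y ∈? map f xs
      where open import Data.List.Membership.DecPropositional _≟_ using (_∈?_)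
    ... | yes y∈ = ∈-map⁻ f y∈
    ... | no y∉ = contradiction (ℕ.≤-trans longer bound) ℕ.1+n≰n
      where
      sub : y ∷ map f xs ⊆ ys
      sub (here refl) = y∈ys
      sub (there z∈) with ∈-map⁻ f z∈
      ... | x , x∈xs , refl = into x∈xs
      longer : suc (length xs) ≤ length ys
      longer = subst (λ n → suc n ≤ length ys) (length-map f xs)
        (Unique-⊆⇒length≤
          (All.tabulate (λ z∈ y≡z → y∉ (subst (_∈ _) (sym y≡z) z∈)) ∷ Unique-map⁺ inj xs!) sub)

  module _ {P : A → Set} (P? : Decidable P) where

    length-filter-∁ : ∀ xs → length xs ≡ length (filter P? xs) + length (filter (∁? P?) xs)
    length-filter-∁ [] = refl
    length-filter-∁ (x ∷ xs) with P? x
    ... | yes _ = cong suc (length-filter-∁ xs)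
    ... | no _  = trans (cong suc (length-filter-∁ xs)) (sym (ℕ.+-suc _ _))

  -- One fibre is removed for each entry of `ys`. The bound is asked at a point x of the source,
  -- because the fibre through x is what can be written down explicitly, such as x and -x for
  -- squaring; empty fibres then need no treatment.
  fibres≤⇒length≤ : (f : A → B) → DecidableEquality B → ∀ n → Unique xs →
    (∀ {x} → x ∈ xs → ∃ λ zs → length zs ≤ n × (∀ {z} → z ∈ xs → f z ≡ f x → z ∈ zs)) →
    (∀ {x} → x ∈ xs → f x ∈ ys) → length xs ≤ length ys * n
  fibres≤⇒length≤ {xs = []} {[]} f _≟_ n _ _ _ = z≤n
  fibres≤⇒length≤ {xs = x ∷ xs} {[]} f _≟_ n _ _ into with into (here refl)
  ... | ()
  fibres≤⇒length≤ {xs = xs} {y ∷ ys} f _≟_ n xs! fibre into = begin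
    length xs                                        ≡⟨ length-filter-∁ P? xs ⟩
    length (filter P? xs) + length (filter (∁? P?) xs) ≤⟨ ℕ.+-mono-≤ fibre-y rest ⟩
    n + length ys * n                                ∎
    where
    open ℕ.≤-Reasoning
    P? = λ x → f x ≟ y
    fibre-y : length (filter P? xs) ≤ n
    fibre-y with filter P? xs in eq
    ... | [] = z≤n
    ... | z ∷ zs with ∈-filter⁻ P? {xs = xs} (subst (z ∈_) (sym eq) (here refl))
    ... | z∈xs , fz≡y with fibre z∈xs
    ... | ws , ws≤n , sub = ℕ.≤-trans
          (Unique-⊆⇒length≤ (subst Unique eq (Unique.filter⁺ P? xs!))
            (λ w∈ → let w∈xs , fw≡y = ∈-filter⁻ P? {xs = xs} (subst (_ ∈_) (sym eq) w∈)
                    in sub w∈xs (trans fw≡y (sym fz≡y)))) ws≤n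
    rest : length (filter (∁? P?) xs) ≤ length ys * n
    rest = fibres≤⇒length≤ f _≟_ n (Unique.filter⁺ (∁? P?) xs!)
      (λ x∈ → let zs , zs≤n , sub = fibre (proj₁ (∈-filter⁻ (∁? P?) {xs = xs} x∈))
              in zs , zs≤n , λ z∈ → sub (proj₁ (∈-filter⁻ (∁? P?) {xs = xs} z∈)))
      into′
      where
      into′ : ∀ {x} → x ∈ filter (∁? P?) xs → f x ∈ ys
      into′ x∈ with ∈-filter⁻ (∁? P?) {xs = xs} x∈
      ... | x∈xs , fx≢y with into x∈xs
      ... | here fx≡y = contradiction fx≡y fx≢y
      ... | there fx∈ = fx∈

  AllPairs-¬⇒≡ : {R : A → A → Set} → Symmetric R → AllPairs (λ x y → ¬ R x y) xs →
    ∀ {x y} → x ∈ xs → y ∈ xs → R x y → x ≡ y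
  AllPairs-¬⇒≡ sym-R (_ ∷ _)  (here refl) (here refl) _ = refl
  AllPairs-¬⇒≡ sym-R (px ∷ _) (here refl) (there y∈) r = contradiction r (All.lookup px y∈)
  AllPairs-¬⇒≡ sym-R (px ∷ _) (there x∈) (here refl) r = contradiction (sym-R r) (All.lookup px x∈)
  AllPairs-¬⇒≡ sym-R (_ ∷ ps) (there x∈) (there y∈) r = AllPairs-¬⇒≡ sym-R ps x∈ y∈ r

  length-filter-map : (f : A → B) {P : B → Set} (P? : Decidable P) → ∀ xs →
    length (filter P? (map f xs)) ≡ length (filter (P? ∘ f) xs)
  length-filter-map f P? [] = refl
  length-filter-map f P? (x ∷ xs) with P? (f x)
  ... | yes _ = cong suc (length-filter-map f P? xs)
  ... | no _  = length-filter-map f P? xs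

  -- This serves for point counts modulo n: Q marks the exceptional fibres, which hold one point
  -- each, and every other fibre contributes a multiple of n.
  count-pairs : {P : A × B → Set} (P? : Decidable P) {Q : A → Set} (Q? : Decidable Q) →
    ∀ n xs ys →
    (∀ x → Q x → length (filter (λ y → P? (x , y)) ys) ≡ 1) →
    (∀ x → ¬ Q x → ∃ λ m → length (filter (λ y → P? (x , y)) ys) ≡ n * m) →
    ∃ λ m → length (filter P? (cartesianProduct xs ys)) ≡ length (filter Q? xs) + n * m
  count-pairs P? Q? n [] ys one mult = 0 , solve 1 (λ n → con 0 := n :* con 0) refl n
    where open +-*-Solver
  count-pairs P? Q? n (x ∷ xs) ys one mult with count-pairs P? Q? n xs ys one mult
  ... | m , eq with split
    where
    split : length (filter P? (cartesianProduct (x ∷ xs) ys)) ≡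
            length (filter (λ y → P? (x , y)) ys) + length (filter P? (cartesianProduct xs ys))
    split = trans (cong length (filter-++ P? (map (x ,_) ys) (cartesianProduct xs ys)))
      (trans (length-++ (filter P? (map (x ,_) ys)))
        (cong (_+ length (filter P? (cartesianProduct xs ys))) (length-filter-map (x ,_) P? ys)))
  ... | split with Q? x
  ... | yes q = m , trans split (cong₂ _+_ (one x q) eq)
  ... | no ¬q with mult x ¬q
  ... | k , eq′ = k + m , trans split (trans (cong₂ _+_ eq′ eq)
      (solve 4 (λ n k m l → n :* k :+ (l :+ n :* m) := l :+ n :* (k :+ m)) refl n k m _))
    where open +-*-Solver

  -- The absorption identity, obtained from Pascal's rule.
  k*nCk : ∀ n k → suc k * (suc n C suc k) ≡ suc n * (n C k)
  k*nCk n zero = trans (ℕ.*-identityˡ _) (trans (nC1≡n (suc n)) (sym (ℕ.*-identityʳ (suc n))))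
  k*nCk zero (suc k) = ℕ.*-zeroʳ (suc (suc k))
  k*nCk (suc n) (suc k) = begin
    suc (suc k) * (suc (suc n) C suc (suc k))
      ≡⟨ cong (suc (suc k) *_) (nCk+nC[k+1]≡[n+1]C[k+1] (suc n) (suc k)) ⟨
    suc (suc k) * (a + b)
      ≡⟨ solve 3 (λ k a b → (con 2 :+ k) :* (a :+ b) := a :+ (con 1 :+ k) :* a :+ (con 2 :+ k) :* b) refl k a b ⟩
    a + suc k * a + suc (suc k) * b
      ≡⟨ cong₂ (λ s t → a + s + t) (k*nCk n k) (k*nCk n (suc k)) ⟩
    a + suc n * (n C k) + suc n * (n C suc k)
      ≡⟨ solve 4 (λ n a c d → a :+ (con 1 :+ n) :* c :+ (con 1 :+ n) :* d := a :+ (con 1 :+ n) :* (c :+ d)) refl n a (n C k) (n C suc k) ⟩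
    a + suc n * (n C k + n C suc k)
      ≡⟨ cong (λ z → a + suc n * z) (nCk+nC[k+1]≡[n+1]C[k+1] n k) ⟩
    suc (suc n) * a ∎
    where
    open ≡-Reasoning
    open +-*-Solver
    a = suc n C suc k
    b = suc n C suc (suc k)

  -- By absorption the prime divides `suc k` times the binomial coefficient, and it is too large to
  -- divide `suc k`.
  prime∣nCk : ∀ {p k} → Prime (suc p) → k < p → suc p ∣ (suc p C suc k)
  prime∣nCk {p} {k} pr k<p with euclidsLemma (suc k) (suc p C suc k) pr
    (divides (p C k) (trans (k*nCk p k) (ℕ.*-comm (suc p) (p C k))))
  ... | inj₁ p∣k = contradiction p∣k (>⇒∤ (s≤s k<p))
  ... | inj₂ p∣C = p∣C

  length-cartesianProduct : ∀ {A B : Set} (xs : List A) (ys : List B) →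
    length (cartesianProduct xs ys) ≡ length xs * length ys
  length-cartesianProduct [] ys = refl
  length-cartesianProduct (x ∷ xs) ys = trans (length-++ (map (x ,_) ys))
    (cong₂ _+_ (length-map (x ,_) ys) (length-cartesianProduct xs ys))

  ∣-from-≡ : ∀ {n} r {a b} → r + n * a ≡ n * b → n ∣ r
  ∣-from-≡ {n} r {a} {b} eq =
    ∣m+n∣m⇒∣n (subst (n ∣_) (trans (sym eq) (ℕ.+-comm r _)) (m∣m*n b)) (m∣m*n a)

  -- For comparing two point counts: c and d are the numbers of exceptional fibres, r and s the
  -- contributions of the others, and the `suc` is the point at infinity.
  residues≡ : ∀ {a b c d r s t : ℕ} → a ≡ suc (c + r) → c ≡ t → b ≡ suc (d + s) → d ≡ 0 → a ≡ b → t + r ≡ s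
  residues≡ refl refl refl refl eq = ℕ.suc-injective eq

  prime>3⇒odd : ∀ {p} → Prime p → p > 3 → ∃ λ s → p ≡ 1 + s * 2
  prime>3⇒odd {p} pr p>3 with p % 2 in eq | m%n<n p 2 | m≡m%n+[m/n]*n p 2
  ... | 0 | _ | _ with prime⇒irreducible pr (m%n≡0⇒n∣m p 2 eq)
  ...   | inj₁ ()
  ...   | inj₂ refl with () ← ℕ.≤⇒≯ (s≤s (s≤s z≤n)) p>3
  prime>3⇒odd {p} pr p>3 | 1 | _ | p≡ = p ℕ./ 2 , p≡
  prime>3⇒odd {p} pr p>3 | suc (suc _) | s≤s (s≤s ()) | _

-- Field arithmetic.

module Field (F : FiniteField) where
  open FiniteField F

  commutativeRing : CommutativeRing 0ℓ 0ℓ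
  commutativeRing = record { isCommutativeRing = isCommutativeRing }

  open CommutativeRing commutativeRing public
    using (+-identityˡ; +-identityʳ; -‿inverseʳ;
           *-comm; *-assoc; *-identityˡ; *-identityʳ; zeroˡ; zeroʳ; ring; semiring; commutativeSemiring)
  open import Algebra.Properties.Ring ring public
    using (-‿involutive; -0#≈0#; +-cancelˡ; +-cancelʳ)
  open IntegerCoefficients commutativeRing public

  # : ℕ → Carrier
  # n = ι (+ n)

  nonzero-1 : 1# ≢ 0#
  nonzero-1 = 0≢1 ∘ sym

  -- A polynomial identity modulo the hypothesis l ≡ r, with cofactor c.
  mod : ∀ {l r a b} c → l ≡ r → a + c * r ≡ b + c * l → a ≡ b
  mod c refl eq = +-cancelʳ _ _ _ eq

  mod-zero : ∀ {a b} → a - b ≡ 0# → a ≡ b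
  mod-zero {a} {b} eq = +-cancelʳ (- b) a b (trans eq (sym (-‿inverseʳ b)))

  sub-zero : ∀ {a b} → a ≡ b → a - b ≡ 0#
  sub-zero {a} refl = -‿inverseʳ a

  *-inverse-cancel : ∀ {c} → c ≢ 0# → ∀ a → c ⁻¹ * (c * a) ≡ a
  *-inverse-cancel {c} c≢0 a = begin
    c ⁻¹ * (c * a) ≡⟨ solve 3 (λ i c a → i :* (c :* a) := c :* i :* a) refl (c ⁻¹) c a ⟩
    c * c ⁻¹ * a   ≡⟨ cong (_* a) (inverse c c≢0) ⟩
    1# * a         ≡⟨ *-identityˡ a ⟩
    a              ∎
    where open ≡-Reasoning

  *-cancelˡ : ∀ {c a b} → c ≢ 0# → c * a ≡ c * b → a ≡ b
  *-cancelˡ {c} {a} {b} c≢0 eq =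
    trans (sym (*-inverse-cancel c≢0 a)) (trans (cong (c ⁻¹ *_) eq) (*-inverse-cancel c≢0 b))

  integral : ∀ {a b} → a * b ≡ 0# → a ≢ 0# → b ≡ 0#
  integral {a} eq a≢0 = *-cancelˡ a≢0 (trans eq (sym (zeroʳ a)))

  integral-⊎ : ∀ {a b} → a * b ≡ 0# → a ≡ 0# ⊎ b ≡ 0#
  integral-⊎ {a} eq with a ≟ 0#
  ... | yes a≡0 = inj₁ a≡0
  ... | no a≢0 = inj₂ (integral eq a≢0)

  *-nonzero : ∀ {a b} → a ≢ 0# → b ≢ 0# → a * b ≢ 0#
  *-nonzero a≢0 b≢0 eq = b≢0 (integral eq a≢0)

  infixl 7 _/_
  _/_ : Carrier → Carrier → Carrier
  a / b = a * b ⁻¹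

  *-/ : ∀ {b} → b ≢ 0# → ∀ a → b * (a / b) ≡ a
  *-/ {b} b≢0 a = trans (solve 3 (λ a b i → b :* (a :* i) := i :* (b :* a)) refl a b (b ⁻¹))
                        (*-inverse-cancel b≢0 a)

  /-nonzero : ∀ {a b} → a ≢ 0# → b ≢ 0# → a / b ≢ 0#
  /-nonzero {a} {b} a≢0 b≢0 eq =
    a≢0 (trans (sym (*-/ b≢0 a)) (trans (cong (b *_) eq) (zeroʳ b)))

  -‿nonzero : ∀ {a} → a ≢ 0# → - a ≢ 0#
  -‿nonzero {a} a≢0 eq = a≢0 (trans (sym (-‿involutive a)) (trans (cong -_ eq) -0#≈0#))

  x²≡y²⇒x≡±y : ∀ {x y} → x * x ≡ y * y → x ≡ y ⊎ x ≡ - y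
  x²≡y²⇒x≡±y {x} {y} eq with integral-⊎ {x - y} {x + y}
    (mod 1# eq (solve 2 (λ x y → (x :- y) :* (x :+ y) :+ con (+ 1) :* (y :* y) :=
                                 con (+ 0) :+ con (+ 1) :* (x :* x)) refl x y))
  ... | inj₁ x-y≡0 = inj₁ (mod-zero x-y≡0)
  ... | inj₂ x+y≡0 = inj₂ (mod 1# x+y≡0 (solve 2 (λ x y → x :+ con (+ 1) :* con (+ 0) :=
                                 :- y :+ con (+ 1) :* (x :+ y)) refl x y))

  x≢-x : # 2 ≢ 0# → ∀ {x} → x ≢ 0# → x ≢ - x
  x≢-x 2≢0 {x} x≢0 eq = x≢0 (integral
    (mod 1# eq (solve 1 (λ x → con (+ 2) :* x :+ con (+ 1) :* :- x := con (+ 0) :+ con (+ 1) :* x) refl x)) 2≢0)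

  IsSquare IsCube : Carrier → Set
  IsSquare a = ∃ λ t → t * t ≡ a
  IsCube   a = ∃ λ t → t * t * t ≡ a

-- The chord-and-tangent law and homomorphisms given by affine maps.

module AffineMaps (F : FiniteField) where
  open FiniteField F
  open Curve F
  open Field F

  Affine : Set
  Affine = Carrier × Carrier

  -- The slope is a solution of a linear equation rather than a quotient, so a map can be tested on
  -- it by polynomial identities. The condition on y in `tangent` mirrors the test by which `addPt`
  -- recognises opposite points.
  data Slope (l : Carrier) : Affine → Affine → Set where
    chord : ∀ {x₁ y₁ x₂ y₂} → x₁ ≢ x₂ → (x₂ - x₁) * l ≡ y₂ - y₁ → Slope l (x₁ , y₁) (x₂ , y₂)
    tangent : ∀ {x y} → y ≢ - y → (2# * y) * l ≡ 3# * x * x → Slope l (x , y) (x , y)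

  thirdX : Carrier → Carrier → Carrier → Carrier
  thirdX l x₁ x₂ = l * l - x₁ - x₂

  addSlope : Carrier → Affine → Affine → Affine
  addSlope l (x₁ , y₁) (x₂ , _) = thirdX l x₁ x₂ , l * (x₁ - thirdX l x₁ x₂) - y₁

  On : Carrier → Affine → Set
  On B (x , y) = OnCurve B x y

  neg : Affine → Affine
  neg (x , y) = x , - y

  2y≢0 : ∀ {y} → y ≢ - y → 2# * y ≢ 0#
  2y≢0 {y} y≢-y eq = y≢-y (mod 1# eq
    (solve 1 (λ y → y :+ con (+ 1) :* con (+ 0) := :- y :+ con (+ 1) :* ((con (+ 2)) :* y)) refl y))

  data Position : Affine → Affine → Set where
    secant   : ∀ {P Q} l → Slope l P Q → Position P Q
    opposite : ∀ {Q} → Position (neg Q) Q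

  x₁≢x₂⇒x₂-x₁≢0 : ∀ {x₁ x₂} → x₁ ≢ x₂ → x₂ - x₁ ≢ 0#
  x₁≢x₂⇒x₂-x₁≢0 x₁≢x₂ eq = x₁≢x₂ (sym (mod-zero eq))

  -- On the curve equal abscissae force y₁ = ±y₂. Once opposite points are set aside, the two points
  -- coincide and the tangent applies.
  position : ∀ {B} P Q → On B P → On B Q → Position P Q
  position (x₁ , y₁) (x₂ , y₂) onP onQ with x₁ ≟ x₂
  ... | no x₁≢x₂ = secant ((y₂ - y₁) / (x₂ - x₁)) (chord x₁≢x₂ (*-/ (x₁≢x₂⇒x₂-x₁≢0 x₁≢x₂) _))
  ... | yes refl with y₁ ≟ (- y₂)
  ...   | yes refl = opposite
  ...   | no y₁≢-y₂ with x²≡y²⇒x≡±y (trans onP (sym onQ))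
  ...     | inj₁ refl = secant ((3# * x₁ * x₁) / (2# * y₁)) (tangent y₁≢-y₂ (*-/ (2y≢0 y₁≢-y₂) _))
  ...     | inj₂ y₁≡-y₂ = contradiction y₁≡-y₂ y₁≢-y₂

  addPt-opposite : ∀ B Q → addPt B (just (neg Q)) (just Q) ≡ nothing
  addPt-opposite B (x , y) with x ≟ x
  ... | no x≢x = contradiction refl x≢x
  ... | yes _ with (- y) ≟ (- y)
  ...   | yes _ = refl
  ...   | no ≢ = contradiction refl ≢

  private
    slope-unique : ∀ {l c d} → c ≢ 0# → c * l ≡ d → d / c ≡ l
    slope-unique c≢0 refl = *-cancelˡ c≢0 (*-/ c≢0 _)

  addPt-secant : ∀ B {l P Q} → Slope l P Q → addPt B (just P) (just Q) ≡ just (addSlope l P Q)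
  addPt-secant B (chord {x₁} {y₁} {x₂} {y₂} x₁≢x₂ eq) with x₁ ≟ x₂
  ... | yes x₁≡x₂ = contradiction x₁≡x₂ x₁≢x₂
  ... | no _ = cong (λ l → just (addSlope l (x₁ , y₁) (x₂ , y₂)))
                 (slope-unique (x₁≢x₂⇒x₂-x₁≢0 x₁≢x₂) eq)
  addPt-secant B (tangent {x} {y} y≢-y eq) with x ≟ x
  ... | no x≢x = contradiction refl x≢x
  ... | yes _ with y ≟ (- y)
  ...   | yes y≡-y = contradiction y≡-y y≢-y
  ...   | no _ = cong (λ l → just (addSlope l (x , y) (x , y))) (slope-unique (2y≢0 y≢-y) eq)

  addPt-nothing⇒opposite : ∀ B P Q → addPt B (just P) (just Q) ≡ nothing → P ≡ neg Q
  addPt-nothing⇒opposite B (x₁ , y₁) (x₂ , y₂) eq with x₁ ≟ x₂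
  addPt-nothing⇒opposite B (x₁ , y₁) (x₂ , y₂) () | no _
  ... | yes refl with y₁ ≟ (- y₂)
  ...   | yes refl = refl
  addPt-nothing⇒opposite B (x₁ , y₁) (x₂ , y₂) () | yes refl | no _

  neg-involutive : ∀ P → neg (neg P) ≡ P
  neg-involutive (x , y) = cong (x ,_) (-‿involutive y)

  On-neg : ∀ {B} P → On B P → On B (neg P)
  On-neg {B} (x , y) on = trans (solve 1 (λ y → :- y :* :- y := y :* y) refl y) on

  -- Acting on affine points only, such a map sends nothing but O to O. Since `Slope` excludes
  -- vertical lines, `f-slope` also says that points which are not opposite have images which are
  -- not opposite.
  record AffineHom (B₁ B₂ : Carrier) : Set where
    field
      f           : Affine → Affine
      f-on        : ∀ {P} → On B₁ P → On B₂ (f P)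
      f-neg       : ∀ P → f (neg P) ≡ neg (f P)
      f-slope     : ∀ {l P Q} → On B₁ P → On B₁ Q → Slope l P Q →
                    ∃ λ l′ → Slope l′ (f P) (f Q) × addSlope l′ (f P) (f Q) ≡ f (addSlope l P Q)

    ⟪_⟫ : Point → Point
    ⟪_⟫ = Maybe.map f

    preserves : ∀ P → IsPoint B₁ P → IsPoint B₂ ⟪ P ⟫
    preserves nothing  _  = tt
    preserves (just P) on = f-on on

    homo : ∀ P Q → IsPoint B₁ P → IsPoint B₁ Q → ⟪ addPt B₁ P Q ⟫ ≡ addPt B₂ ⟪ P ⟫ ⟪ Q ⟫
    homo nothing  Q onP onQ = refl
    homo (just P) nothing onP onQ = refl
    homo (just P) (just Q) onP onQ with position P Q onP onQ
    ... | opposite rewrite f-neg Q | addPt-opposite B₁ Q | addPt-opposite B₂ (f Q) = refl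
    ... | secant l s with f-slope onP onQ s
    ...   | l′ , s′ , eq rewrite addPt-secant B₁ s | addPt-secant B₂ s′ = cong just (sym eq)

    -- φ(P − Q) = φQ − φQ = O, and only O is mapped to O.
    injective : ∀ P Q → IsPoint B₁ P → IsPoint B₁ Q → ⟪ P ⟫ ≡ ⟪ Q ⟫ → P ≡ Q
    injective nothing nothing _ _ _ = refl
    injective nothing (just _) _ _ ()
    injective (just _) nothing _ _ ()
    injective (just P) (just Q) onP onQ eq =
      cong just (trans (addPt-nothing⇒opposite B₁ P (neg Q) (map-nothing _ P-Q↦O)) (neg-involutive Q))
      where
      open ≡-Reasoning
      map-nothing : ∀ P → ⟪ P ⟫ ≡ nothing → P ≡ nothing
      map-nothing nothing _ = refl
      map-nothing (just _) ()
      P-Q↦O : ⟪ addPt B₁ (just P) (just (neg Q)) ⟫ ≡ nothing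
      P-Q↦O = begin
        ⟪ addPt B₁ (just P) (just (neg Q)) ⟫       ≡⟨ homo (just P) (just (neg Q)) onP (On-neg Q onQ) ⟩
        addPt B₂ ⟪ just P ⟫ (just (f (neg Q)))     ≡⟨ cong (λ S → addPt B₂ S (just (f (neg Q)))) eq ⟩
        addPt B₂ (just (f Q)) (just (f (neg Q)))   ≡⟨ cong₂ (λ S T → addPt B₂ (just S) (just T))
                                                        (sym (neg-involutive (f Q))) (f-neg Q) ⟩
        addPt B₂ (just (neg (neg (f Q)))) (just (neg (f Q))) ≡⟨ addPt-opposite B₂ (neg (f Q)) ⟩
        nothing                                    ∎

  infixr 9 _⊙_
  _⊙_ : ∀ {B₁ B₂ B₃} → AffineHom B₂ B₃ → AffineHom B₁ B₂ → AffineHom B₁ B₃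
  g ⊙ h = record
    { f       = G.f ∘ H.f
    ; f-on    = G.f-on ∘ H.f-on
    ; f-neg   = λ P → trans (cong G.f (H.f-neg P)) (G.f-neg (H.f P))
    ; f-slope = λ onP onQ s →
        let l′ , s′ , eq′ = H.f-slope onP onQ s
            l″ , s″ , eq″ = G.f-slope (H.f-on onP) (H.f-on onQ) s′
        in l″ , s″ , trans eq″ (cong G.f eq′)
    }
    where
    module G = AffineHom g
    module H = AffineHom h

  affineOnCurve? : ∀ B (P : Affine) → Dec (On B P)
  affineOnCurve? B P = onCurve? B (proj₁ P) (proj₂ P)

  isPoint? : ∀ B P → Dec (IsPoint B P)
  isPoint? B nothing  = yes tt
  isPoint? B (just P) = affineOnCurve? B P

  _≟ₚ_ : DecidableEquality Point
  _≟ₚ_ = ≡-dec (Product.≡-dec _≟_ _≟_)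

  plane : List Affine
  plane = cartesianProduct elements elements

  plane-complete : ∀ P → P ∈ plane
  plane-complete (x , y) = ∈-cartesianProduct⁺ (complete x) (complete y)

  plane-unique : Unique plane
  plane-unique = Unique.cartesianProduct⁺ unique unique

  points : Carrier → List Point
  points B = nothing ∷ map just (filter (affineOnCurve? B) plane)

  length-points : ∀ B → length (points B) ≡ #E B
  length-points B = cong suc (length-map just (filter (affineOnCurve? B) plane))

  points-unique : ∀ B → Unique (points B)
  points-unique B =
    All.tabulate (λ P∈ eq → case-nothing (∈-map⁻ just P∈) eq) ∷
    Unique.map⁺ just-injective (Unique.filter⁺ _ plane-unique)
    where
    case-nothing : ∀ {P} → (∃ λ Q → Q ∈ filter (affineOnCurve? B) plane × P ≡ just Q) → nothing ≢ P
    case-nothing (_ , _ , refl) ()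

  ∈-points⁺ : ∀ {B} P → IsPoint B P → P ∈ points B
  ∈-points⁺ nothing  _  = here refl
  ∈-points⁺ (just P) on = there (∈-map⁺ just (∈-filter⁺ _ (plane-complete P) on))

  ∈-points⁻ : ∀ {B P} → P ∈ points B → IsPoint B P
  ∈-points⁻ (here refl) = tt
  ∈-points⁻ {B} (there P∈) with ∈-map⁻ just P∈
  ... | Q , Q∈ , refl = proj₂ (∈-filter⁻ (affineOnCurve? B) {xs = plane} Q∈)

  AffineHom⇒GroupIso : ∀ {B₁ B₂} → #E B₁ ≡ #E B₂ → AffineHom B₁ B₂ → GroupIso B₁ B₂
  AffineHom⇒GroupIso {B₁} {B₂} #≡ h = record
    { φ = ⟪_⟫ ; preserves = preserves ; injective = injective ; homo = homo
    ; surjective = λ R onR →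
        let P , P∈ , R≡ = injectiveOn⇒surjectiveOn ⟪_⟫ _≟ₚ_ (points-unique B₁)
              (λ p q → injective _ _ (∈-points⁻ p) (∈-points⁻ q))
              (λ p → ∈-points⁺ _ (preserves _ (∈-points⁻ p)))
              (ℕ.≤-reflexive (trans (length-points B₂) (trans (sym #≡) (sym (length-points B₁)))))
              (∈-points⁺ R onR)
        in P , ∈-points⁻ P∈ , sym R≡
    }
    where open AffineHom h

  GroupIso⇒#E≡ : ∀ {B₁ B₂} → GroupIso B₁ B₂ → #E B₁ ≡ #E B₂
  GroupIso⇒#E≡ {B₁} {B₂} iso = trans (sym (length-points B₁)) (trans
    (trans (sym (length-map φ (points B₁)))
      (Unique-≡-length (Unique-map⁺ φ inj (points-unique B₁)) (points-unique B₂) ⊆₁ ⊆₂))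
    (length-points B₂))
    where
    open GroupIso iso
    inj : InjectiveOn φ (points B₁)
    inj p q = injective _ _ (∈-points⁻ p) (∈-points⁻ q)
    ⊆₁ : ∀ {R} → R ∈ map φ (points B₁) → R ∈ points B₂
    ⊆₁ R∈ with ∈-map⁻ φ R∈
    ... | P , P∈ , refl = ∈-points⁺ _ (preserves P (∈-points⁻ P∈))
    ⊆₂ : ∀ {R} → R ∈ points B₂ → R ∈ map φ (points B₁)
    ⊆₂ R∈ with surjective _ (∈-points⁻ R∈)
    ... | P , onP , refl = ∈-map⁺ φ (∈-points⁺ P onP)

-- Third intersection points, closure under addition, inverse isomorphisms.

module Secants (F : FiniteField) where
  open FiniteField F
  open Curve F
  open Field F
  open AffineMaps F

  -- The cubic x³ + B − (l x + ν)², with l the slope and ν = y₁ − l x₁, has the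
  -- roots x₁, x₂ and x₃ = thirdX l x₁ x₂.
  module Vieta {B l x₁ y₁ x₂ y₂} (on₁ : OnCurve B x₁ y₁) (on₂ : OnCurve B x₂ y₂)
               (s : Slope l (x₁ , y₁) (x₂ , y₂)) where

    ν x₃ : Carrier
    ν  = y₁ - l * x₁
    x₃ = thirdX l x₁ x₂

    private
      -- For a chord this is the difference of the two curve equations divided by x₂ - x₁; for a
      -- tangent it is the slope equation 2 y l = 3 x². Both kinds of line are alike from here on.
      quotient : ∀ {x₁ y₁ x₂ y₂} → OnCurve B x₁ y₁ → OnCurve B x₂ y₂ → Slope l (x₁ , y₁) (x₂ , y₂) →
        x₁ * x₁ + x₁ * x₂ + x₂ * x₂ ≡ l * l * (x₁ + x₂) + # 2 * (l * (y₁ - l * x₁))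
      quotient on₁ on₂ (chord {x₁} {y₁} {x₂} {y₂} x₁≢x₂ eq) = *-cancelˡ (x₁≢x₂⇒x₂-x₁≢0 x₁≢x₂)
        (mod (# 1) on₁ (mod (- # 1) on₂ (mod (- ((x₂ - x₁) * l + y₂ + y₁)) eq (solve 6 (λ B l x₁ y₁ x₂ y₂ →
            (x₂ :- x₁) :* (x₁ :* x₁ :+ x₁ :* x₂ :+ x₂ :* x₂)
              :+ con (+ 1) :* (x₁ :* x₁ :* x₁ :+ B)
              :+ :- (con (+ 1)) :* (x₂ :* x₂ :* x₂ :+ B)
              :+ :- ((x₂ :- x₁) :* l :+ y₂ :+ y₁) :* (y₂ :- y₁) :=
            (x₂ :- x₁) :* (l :* l :* (x₁ :+ x₂) :+ con (+ 2) :* (l :* (y₁ :- l :* x₁)))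
              :+ con (+ 1) :* (y₁ :* y₁)
              :+ :- (con (+ 1)) :* (y₂ :* y₂)
              :+ :- ((x₂ :- x₁) :* l :+ y₂ :+ y₁) :* ((x₂ :- x₁) :* l)) refl B l x₁ y₁ x₂ y₂))))
      quotient on₁ on₂ (tangent {x} {y} _ eq) =
        mod (- # 1) eq (solve 3 (λ l x y →
            x :* x :+ x :* x :+ x :* x
              :+ :- (con (+ 1)) :* (con (+ 3) :* x :* x) :=
            l :* l :* (x :+ x) :+ con (+ 2) :* (l :* (y :- l :* x))
              :+ :- (con (+ 1)) :* (con (+ 2) :* y :* l)) refl l x y)

    e₁ : x₁ + x₂ + x₃ ≡ l * l
    e₁ = solve 3 (λ l x₁ x₂ →
        x₁ :+ x₂ :+ (l :* l :- x₁ :- x₂) :=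
        l :* l) refl l x₁ x₂

    e₂ : x₁ * x₂ + x₃ * (x₁ + x₂) ≡ - (# 2 * (l * ν))
    e₂ = mod (- # 1) (quotient on₁ on₂ s) (solve 4 (λ l x₁ y₁ x₂ →
        x₁ :* x₂ :+ (l :* l :- x₁ :- x₂) :* (x₁ :+ x₂)
          :+ :- (con (+ 1)) :* (l :* l :* (x₁ :+ x₂) :+ con (+ 2) :* (l :* (y₁ :- l :* x₁))) :=
        :- (con (+ 2) :* (l :* (y₁ :- l :* x₁)))
          :+ :- (con (+ 1)) :* (x₁ :* x₁ :+ x₁ :* x₂ :+ x₂ :* x₂)) refl l x₁ y₁ x₂)

    e₃ : x₁ * x₂ * x₃ ≡ ν * ν - B
    e₃ = mod (- # 1) on₁ (mod x₁ e₂ (solve 5 (λ B l x₁ y₁ x₂ →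
        x₁ :* x₂ :* (l :* l :- x₁ :- x₂)
          :+ :- (con (+ 1)) :* (x₁ :* x₁ :* x₁ :+ B)
          :+ x₁ :* (:- (con (+ 2) :* (l :* (y₁ :- l :* x₁)))) :=
        (y₁ :- l :* x₁) :* (y₁ :- l :* x₁) :- B
          :+ :- (con (+ 1)) :* (y₁ :* y₁)
          :+ x₁ :* (x₁ :* x₂ :+ (l :* l :- x₁ :- x₂) :* (x₁ :+ x₂))) refl B l x₁ y₁ x₂))

    on-line₁ : y₁ ≡ l * x₁ + ν
    on-line₁ = solve 3 (λ l x₁ y₁ →
        y₁ :=
        l :* x₁ :+ (y₁ :- l :* x₁)) refl l x₁ y₁

    on-line₂ : y₂ ≡ l * x₂ + ν
    on-line₂ = line s
      where
      line : ∀ {x₁ y₁ x₂ y₂} → Slope l (x₁ , y₁) (x₂ , y₂) → y₂ ≡ l * x₂ + (y₁ - l * x₁)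
      line (chord {x₁} {y₁} {x₂} {y₂} _ eq) =
        mod (- # 1) eq (solve 5 (λ l x₁ y₁ x₂ y₂ →
            y₂
              :+ :- (con (+ 1)) :* (y₂ :- y₁) :=
            l :* x₂ :+ (y₁ :- l :* x₁)
              :+ :- (con (+ 1)) :* ((x₂ :- x₁) :* l)) refl l x₁ y₁ x₂ y₂)
      line (tangent {x} {y} _ _) = solve 3 (λ l x y →
          y :=
          l :* x :+ (y :- l :* x)) refl l x y

    on-third : OnCurve B x₃ (l * x₃ + ν)
    on-third = cubic x₁ x₂ x₃ e₁ e₂ e₃
      where
      -- The cofactors are those of x₃³ - s₁ x₃² + s₂ x₃ - s₃ = 0, which holds because x₃ is a root
      -- of the cubic with elementary symmetric functions s₁, s₂, s₃.
      cubic : ∀ x₁ x₂ x₃ {ν} → x₁ + x₂ + x₃ ≡ l * l → x₁ * x₂ + x₃ * (x₁ + x₂) ≡ - (# 2 * (l * ν)) →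
        x₁ * x₂ * x₃ ≡ ν * ν - B → OnCurve B x₃ (l * x₃ + ν)
      cubic x₁ x₂ x₃ {ν} e₁ e₂ e₃ =
        mod (- (x₃ * x₃)) e₁ (mod x₃ e₂ (mod (- # 1) e₃ (solve 6 (λ B l ν x₁ x₂ x₃ →
            (l :* x₃ :+ ν) :* (l :* x₃ :+ ν)
              :+ :- (x₃ :* x₃) :* (l :* l)
              :+ x₃ :* (:- (con (+ 2) :* (l :* ν)))
              :+ :- (con (+ 1)) :* (ν :* ν :- B) :=
            x₃ :* x₃ :* x₃ :+ B
              :+ :- (x₃ :* x₃) :* (x₁ :+ x₂ :+ x₃)
              :+ x₃ :* (x₁ :* x₂ :+ x₃ :* (x₁ :+ x₂))
              :+ :- (con (+ 1)) :* (x₁ :* x₂ :* x₃)) refl B l ν x₁ x₂ x₃)))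

    third-neg : l * (x₁ - x₃) - y₁ ≡ - (l * x₃ + ν)
    third-neg = solve 4 (λ l x₁ y₁ x₃ →
        l :* (x₁ :- x₃) :- y₁ :=
        :- (l :* x₃ :+ (y₁ :- l :* x₁))) refl l x₁ y₁ x₃

    on-addSlope : On B (addSlope l (x₁ , y₁) (x₂ , y₂))
    on-addSlope = trans (cong₂ _*_ third-neg third-neg) (On-neg (x₃ , l * x₃ + ν) on-third)

  -- This lets an inverse map be evaluated at a sum, where being inverse is known only on the curve.
  addPt-closed : ∀ {B} P Q → IsPoint B P → IsPoint B Q → IsPoint B (addPt B P Q)
  addPt-closed nothing  Q       onP onQ = onQ
  addPt-closed (just P) nothing onP onQ = onP
  addPt-closed {B} (just P) (just Q) onP onQ with position P Q onP onQ
  ... | opposite rewrite addPt-opposite B Q = tt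
  ... | secant l s rewrite addPt-secant B s = Vieta.on-addSlope onP onQ s

  -- The 3-isogeny is available only from a nonsquare B, so when B₁ is the square one the
  -- isomorphism is constructed backwards and then inverted.
  GroupIso-sym : ∀ {B₁ B₂} → GroupIso B₁ B₂ → GroupIso B₂ B₁
  GroupIso-sym {B₁} {B₂} iso = record
    { φ = ψ ; preserves = ψ-on
    ; injective  = λ P Q onP onQ eq → trans (sym (φψ P onP)) (trans (cong φ eq) (φψ Q onQ))
    ; surjective = λ R onR → φ R , preserves R onR ,
        injective _ _ (ψ-on _ (preserves R onR)) onR (φψ _ (preserves R onR))
    ; homo = λ P Q onP onQ →
        let onP+Q = addPt-closed P Q onP onQ
            onψP = ψ-on P onP
            onψQ = ψ-on Q onQ
        in injective _ _ (ψ-on _ onP+Q) (addPt-closed (ψ P) (ψ Q) onψP onψQ)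
          (trans (φψ _ onP+Q) (trans (cong₂ (addPt B₂) (sym (φψ P onP)) (sym (φψ Q onQ)))
            (sym (homo (ψ P) (ψ Q) onψP onψQ))))
    }
    where
    open GroupIso iso
    ψ : Point → Point
    ψ R with isPoint? B₂ R
    ... | yes onR = proj₁ (surjective R onR)
    -- A default off the curve, where `GroupIso` demands nothing.
    ... | no _    = nothing
    ψ-on : ∀ R → IsPoint B₂ R → IsPoint B₁ (ψ R)
    ψ-on R onR with isPoint? B₂ R
    ... | yes onR′ = proj₁ (proj₂ (surjective R onR′))
    ... | no ¬onR  = contradiction onR ¬onR
    φψ : ∀ R → IsPoint B₂ R → φ (ψ R) ≡ R
    φψ R onR with isPoint? B₂ R
    ... | yes onR′ = proj₂ (proj₂ (surjective R onR′))
    ... | no ¬onR  = contradiction onR ¬onR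

-- The 3-isogeny (x , y) ↦ ((x³ + 4B) / x² , y (x³ − 8B) / x³) onto E_{−27B}, whose
-- kernel {O , (0 , ±√B)} has no rational point besides O when B is not a square.
module ThreeIsogeny (F : FiniteField)
  (2≢0 : Field.# F 2 ≢ FiniteField.0# F) (3≢0 : Field.# F 3 ≢ FiniteField.0# F)
  (B : FiniteField.Carrier F) (B-nonsquare : ¬ Field.IsSquare F B) where

  open FiniteField F
  open Field F
  open Curve F
  open AffineMaps F
  open Secants F

  B′ : Carrier
  B′ = - (# 27 * B)

  X : Carrier → Carrier
  X x = (x * x * x + # 4 * B) / (x * x)

  Y : Carrier → Carrier → Carrier
  Y x y = y * (x * x * x - # 8 * B) / (x * x * x)

  -- A rational point on the y-axis would exhibit B as y², so `X` and `Y` have no pole at a rational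
  -- affine point.
  x≢0 : ∀ {x y} → OnCurve B x y → x ≢ 0#
  x≢0 {x} {y} on refl = B-nonsquare (y , trans on (solve 1 (λ B →
      con (+ 0) :* (con (+ 0)) :* (con (+ 0)) :+ B :=
      B) refl B))

  X-eq : ∀ {x} → x ≢ 0# → x * x * X x ≡ x * x * x + # 4 * B
  X-eq x≢0 = *-/ (*-nonzero x≢0 x≢0) _

  Y-eq : ∀ {x} → x ≢ 0# → ∀ y → x * x * x * Y x y ≡ y * (x * x * x - # 8 * B)
  Y-eq x≢0 y = *-/ (*-nonzero (*-nonzero x≢0 x≢0) x≢0) _

  Y-neg : ∀ x y → Y x (- y) ≡ - Y x y
  Y-neg x y = solve 3 (λ a c y →
      :- y :* a :* c :=
      :- (y :* a :* c)) refl (x * x * x - # 8 * B) ((x * x * x) ⁻¹) y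

  -- With t = x³ this is the identity (t + B)(t - 8B)² = (t + 4B)³ - 27 B t², which is also where
  -- the -27 comes from.
  image-on : ∀ {x y} → OnCurve B x y → OnCurve B′ (X x) (Y x y)
  image-on {x} {y} on = *-cancelˡ (*-nonzero x³≢0 x³≢0) (begin
    x³ * x³ * (Y x y * Y x y)
      ≡⟨ solve 2 (λ a b →
          a :* a :* (b :* b) :=
          a :* b :* (a :* b)) refl x³ (Y x y) ⟩
    x³ * Y x y * (x³ * Y x y)
      ≡⟨ cong₂ _*_ (Y-eq x≢0′ y) (Y-eq x≢0′ y) ⟩
    y * (x³ - # 8 * B) * (y * (x³ - # 8 * B))
      ≡⟨ mod ((x * x * x - # 8 * B) * (x * x * x - # 8 * B)) on (solve 3 (λ B x y →
          y :* (x :* x :* x :- con (+ 8) :* B) :* (y :* (x :* x :* x :- con (+ 8) :* B))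
            :+ (x :* x :* x :- con (+ 8) :* B) :* (x :* x :* x :- con (+ 8) :* B)
                :* (x :* x :* x :+ B) :=
          (x :* x :* x :+ con (+ 4) :* B) :* (x :* x :* x :+ con (+ 4) :* B) :* (x :* x :* x :+ con (+ 4) :* B)
            :+ x :* x :* x :* (x :* x :* x) :* (:- (con (+ 27) :* B))
            :+ (x :* x :* x :- con (+ 8) :* B) :* (x :* x :* x :- con (+ 8) :* B) :* (y :* y)) refl B x y) ⟩
    (x³ + # 4 * B) * (x³ + # 4 * B) * (x³ + # 4 * B) + x³ * x³ * B′
      ≡⟨ cong (λ z → z * z * z + x³ * x³ * B′) (X-eq x≢0′) ⟨
    x * x * X x * (x * x * X x) * (x * x * X x) + x³ * x³ * B′
      ≡⟨ solve 3 (λ x a b →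
          x :* x :* a :* (x :* x :* a) :* (x :* x :* a) :+ x :* x :* x :* (x :* x :* x) :* b :=
          x :* x :* x :* (x :* x :* x) :* (a :* a :* a :+ b)) refl x (X x) B′ ⟩
    x³ * x³ * (X x * X x * X x + B′) ∎)
    where
    open ≡-Reasoning
    x≢0′ = x≢0 on
    x³ = x * x * x
    x³≢0 = *-nonzero (*-nonzero x≢0′ x≢0′) x≢0′

  image : Affine → Affine
  image (x , y) = X x , Y x y

  -- From x₁²x₂² = 4B(x₁ + x₂) one gets (x₁x₂y₁y₂)² = (B(2(x₁ + x₂)² + x₁x₂))², and with
  -- the right sign (x₂y₁ ± x₁y₂)² = B (x₁ − x₂)²: the line through P and ∓Q meets the
  -- y-axis in a kernel point.
  X-injective : ∀ {x₁ y₁ x₂ y₂} → OnCurve B x₁ y₁ → OnCurve B x₂ y₂ → X x₁ ≡ X x₂ → x₁ ≡ x₂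
  X-injective {x₁} {y₁} {x₂} {y₂} on₁ on₂ X≡ with x₁ ≟ x₂
  ... | yes x₁≡x₂ = x₁≡x₂
  ... | no x₁≢x₂ = contradiction (square (x²≡y²⇒x≡±y product²)) B-nonsquare
    where
    D≢0 : x₁ - x₂ ≢ 0#
    D≢0 = x₁≢x₂ ∘ mod-zero

    cross : (x₁ * x₁ * x₁ + # 4 * B) * (x₂ * x₂) ≡ (x₂ * x₂ * x₂ + # 4 * B) * (x₁ * x₁)
    cross = begin
      (x₁ * x₁ * x₁ + # 4 * B) * (x₂ * x₂) ≡⟨ cong (_* (x₂ * x₂)) (X-eq (x≢0 on₁)) ⟨
      x₁ * x₁ * X x₁ * (x₂ * x₂)           ≡⟨ cong (λ z → x₁ * x₁ * z * (x₂ * x₂)) X≡ ⟩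
      x₁ * x₁ * X x₂ * (x₂ * x₂)           ≡⟨ solve 3 (λ x₁ x₂ a →
          x₁ :* x₁ :* a :* (x₂ :* x₂) :=
          x₂ :* x₂ :* a :* (x₁ :* x₁)) refl x₁ x₂ (X x₂) ⟩
      x₂ * x₂ * X x₂ * (x₁ * x₁)           ≡⟨ cong (_* (x₁ * x₁)) (X-eq (x≢0 on₂)) ⟩
      (x₂ * x₂ * x₂ + # 4 * B) * (x₁ * x₁) ∎
      where open ≡-Reasoning

    e : x₁ * x₂ * (x₁ * x₂) ≡ # 4 * B * (x₁ + x₂)
    e = *-cancelˡ D≢0 (mod (# 1) cross (solve 3 (λ B x₁ x₂ →
        (x₁ :- x₂) :* (x₁ :* x₂ :* (x₁ :* x₂))
          :+ con (+ 1) :* ((x₂ :* x₂ :* x₂ :+ con (+ 4) :* B) :* (x₁ :* x₁)) :=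
        (x₁ :- x₂) :* (con (+ 4) :* B :* (x₁ :+ x₂))
          :+ con (+ 1) :* ((x₁ :* x₁ :* x₁ :+ con (+ 4) :* B) :* (x₂ :* x₂))) refl B x₁ x₂))

    w : Carrier
    w = B * (# 2 * ((x₁ + x₂) * (x₁ + x₂)) + x₁ * x₂)

    product² : x₁ * x₂ * (y₁ * y₂) * (x₁ * x₂ * (y₁ * y₂)) ≡ w * w
    product² = begin
      x₁ * x₂ * (y₁ * y₂) * (x₁ * x₂ * (y₁ * y₂))
        ≡⟨ solve 3 (λ a y₁ y₂ →
            a :* (y₁ :* y₂) :* (a :* (y₁ :* y₂)) :=
            a :* a :* (y₁ :* y₁) :* (y₂ :* y₂)) refl (x₁ * x₂) y₁ y₂ ⟩
      x₁ * x₂ * (x₁ * x₂) * (y₁ * y₁) * (y₂ * y₂)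
        ≡⟨ cong₂ (λ s t → x₁ * x₂ * (x₁ * x₂) * s * t) on₁ on₂ ⟩
      x₁ * x₂ * (x₁ * x₂) * (x₁ * x₁ * x₁ + B) * (x₂ * x₂ * x₂ + B)
        ≡⟨ mod (B * ((x₁ + x₂) * (x₁ + x₂) * (x₁ + x₂)) + x₁ * x₂ * (x₁ * x₂ * (x₁ * x₂) + B * (x₁ + x₂))) e (solve 3 (λ B x₁ x₂ →
            x₁ :* x₂ :* (x₁ :* x₂) :* (x₁ :* x₁ :* x₁ :+ B) :* (x₂ :* x₂ :* x₂ :+ B)
              :+ (B :* ((x₁ :+ x₂) :* (x₁ :+ x₂) :* (x₁ :+ x₂)) :+ x₁ :* x₂ :* (x₁ :* x₂ :* (x₁ :* x₂) :+ B :* (x₁ :+ x₂)))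
                  :* (con (+ 4) :* B :* (x₁ :+ x₂)) :=
            B :* (con (+ 2) :* ((x₁ :+ x₂) :* (x₁ :+ x₂)) :+ x₁ :* x₂)
              :* (B :* (con (+ 2) :* ((x₁ :+ x₂) :* (x₁ :+ x₂)) :+ x₁ :* x₂))
              :+ (B :* ((x₁ :+ x₂) :* (x₁ :+ x₂) :* (x₁ :+ x₂)) :+ x₁ :* x₂ :* (x₁ :* x₂ :* (x₁ :* x₂) :+ B :* (x₁ :+ x₂)))
                  :* (x₁ :* x₂ :* (x₁ :* x₂))) refl B x₁ x₂) ⟩
      w * w ∎
      where open ≡-Reasoning

    quotient-square : ∀ {s} → s * s ≡ B * ((x₁ - x₂) * (x₁ - x₂)) → IsSquare B
    quotient-square {s} s² = s / D , *-cancelˡ (*-nonzero D≢0 D≢0) (begin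
      D * D * (s / D * (s / D))     ≡⟨ solve 2 (λ d a →
          d :* d :* (a :* a) :=
          d :* a :* (d :* a)) refl D (s / D) ⟩
      D * (s / D) * (D * (s / D))   ≡⟨ cong₂ _*_ (*-/ D≢0 s) (*-/ D≢0 s) ⟩
      s * s                         ≡⟨ s² ⟩
      B * (D * D)                   ≡⟨ *-comm _ _ ⟩
      D * D * B                     ∎)
      where
      open ≡-Reasoning
      D = x₁ - x₂

    square : x₁ * x₂ * (y₁ * y₂) ≡ w ⊎ x₁ * x₂ * (y₁ * y₂) ≡ - w → IsSquare B
    square (inj₁ eq) = quotient-square {x₂ * y₁ - x₁ * y₂}
      (mod (x₂ * x₂) on₁ (mod (x₁ * x₁) on₂ (mod (- # 2) eq (mod (x₁ + x₂) e (solve 5 (λ B x₁ y₁ x₂ y₂ →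
          (x₂ :* y₁ :- x₁ :* y₂) :* (x₂ :* y₁ :- x₁ :* y₂)
            :+ x₂ :* x₂ :* (x₁ :* x₁ :* x₁ :+ B)
            :+ x₁ :* x₁ :* (x₂ :* x₂ :* x₂ :+ B)
            :+ :- (con (+ 2)) :* (B :* (con (+ 2) :* ((x₁ :+ x₂) :* (x₁ :+ x₂)) :+ x₁ :* x₂))
            :+ (x₁ :+ x₂) :* (con (+ 4) :* B :* (x₁ :+ x₂)) :=
          B :* ((x₁ :- x₂) :* (x₁ :- x₂))
            :+ x₂ :* x₂ :* (y₁ :* y₁)
            :+ x₁ :* x₁ :* (y₂ :* y₂)
            :+ :- (con (+ 2)) :* (x₁ :* x₂ :* (y₁ :* y₂))
            :+ (x₁ :+ x₂) :* (x₁ :* x₂ :* (x₁ :* x₂))) refl B x₁ y₁ x₂ y₂)))))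
    square (inj₂ eq) = quotient-square {x₂ * y₁ + x₁ * y₂}
      (mod (x₂ * x₂) on₁ (mod (x₁ * x₁) on₂ (mod (# 2) eq (mod (x₁ + x₂) e (solve 5 (λ B x₁ y₁ x₂ y₂ →
          (x₂ :* y₁ :+ x₁ :* y₂) :* (x₂ :* y₁ :+ x₁ :* y₂)
            :+ x₂ :* x₂ :* (x₁ :* x₁ :* x₁ :+ B)
            :+ x₁ :* x₁ :* (x₂ :* x₂ :* x₂ :+ B)
            :+ con (+ 2) :* (:- (B :* (con (+ 2) :* ((x₁ :+ x₂) :* (x₁ :+ x₂)) :+ x₁ :* x₂)))
            :+ (x₁ :+ x₂) :* (con (+ 4) :* B :* (x₁ :+ x₂)) :=
          B :* ((x₁ :- x₂) :* (x₁ :- x₂))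
            :+ x₂ :* x₂ :* (y₁ :* y₁)
            :+ x₁ :* x₁ :* (y₂ :* y₂)
            :+ con (+ 2) :* (x₁ :* x₂ :* (y₁ :* y₂))
            :+ (x₁ :+ x₂) :* (x₁ :* x₂ :* (x₁ :* x₂))) refl B x₁ y₁ x₂ y₂)))))

  -- Λ and N are the solution of (l x + ν)(x³ − 8B) ≡ Λ x (x³ + 4B) + N x³ modulo
  -- the cubic x³ + B − (l x + ν)²: the line y = l x + ν goes to Y = Λ X + N.
  module ImageLine (l ν : Carrier) where

    d Λ N : Carrier
    d = ν * ν - B
    Λ = l * (ν * ν + # 3 * B) / d
    N = (ν * d - # 8 * B * ν - # 4 * B * (l * l * l)) / d

    -- If d vanished, the line y = l x + ν would pass through the point (0 , ν) of the kernel. For a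
    -- line through rational points, d is the product of the three abscissae by `e₃`.
    d≢0 : d ≢ 0#
    d≢0 eq = B-nonsquare (ν , mod-zero eq)

    image-line : ∀ {x} → OnCurve B x (l * x + ν) → Y x (l * x + ν) ≡ Λ * X x + N
    image-line {x} on = *-cancelˡ (*-nonzero d≢0 (*-nonzero (*-nonzero x≢0′ x≢0′) x≢0′)) (begin
      d * x³ * Y x (l * x + ν)                   ≡⟨ *-assoc _ _ _ ⟩
      d * (x³ * Y x (l * x + ν))                 ≡⟨ cong (d *_) (Y-eq x≢0′ _) ⟩
      d * ((l * x + ν) * (x³ - # 8 * B))
        ≡⟨ mod (# 4 * B * l * x - # 8 * B * ν) on (solve 4 (λ B l ν x →
            (ν :* ν :- B) :* ((l :* x :+ ν) :* (x :* x :* x :- con (+ 8) :* B))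
              :+ (con (+ 4) :* B :* l :* x :- con (+ 8) :* B :* ν) :* (x :* x :* x :+ B) :=
            l :* (ν :* ν :+ con (+ 3) :* B) :* (x :* (x :* x :* x :+ con (+ 4) :* B))
              :+ (ν :* (ν :* ν :- B) :- con (+ 8) :* B :* ν :- con (+ 4) :* B :* (l :* l :* l)) :* (x :* x :* x)
              :+ (con (+ 4) :* B :* l :* x :- con (+ 8) :* B :* ν)
                  :* ((l :* x :+ ν) :* (l :* x :+ ν))) refl B l ν x) ⟩
      l * (ν * ν + # 3 * B) * (x * (x³ + # 4 * B)) + (ν * d - # 8 * B * ν - # 4 * B * (l * l * l)) * x³
        ≡⟨ cong₂ _+_ (cong₂ _*_ (*-/ d≢0 _) (cong (x *_) (X-eq x≢0′))) (cong (_* x³) (*-/ d≢0 _)) ⟨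
      d * Λ * (x * (x * x * X x)) + d * N * x³
        ≡⟨ solve 5 (λ d a x b c →
            d :* a :* (x :* (x :* x :* b)) :+ d :* c :* (x :* x :* x) :=
            d :* (x :* x :* x) :* (a :* b :+ c)) refl d Λ x (X x) N ⟩
      d * x³ * (Λ * X x + N)                     ∎)
      where
      open ≡-Reasoning
      x³ = x * x * x
      x≢0′ = x≢0 on

  module ImageSlope {l x₁ y₁ x₂ y₂} (on₁ : OnCurve B x₁ y₁) (on₂ : OnCurve B x₂ y₂)
                    (s : Slope l (x₁ , y₁) (x₂ , y₂)) where
    open Vieta on₁ on₂ s
    open ImageLine l ν

    line₁ : Y x₁ y₁ ≡ Λ * X x₁ + N
    line₁ = subst (λ y → Y x₁ y ≡ Λ * X x₁ + N) (sym on-line₁)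
              (image-line (subst (OnCurve B x₁) on-line₁ on₁))

    line₂ : Y x₂ y₂ ≡ Λ * X x₂ + N
    line₂ = subst (λ y → Y x₂ y ≡ Λ * X x₂ + N) (sym on-line₂)
              (image-line (subst (OnCurve B x₂) on-line₂ on₂))

    line₃ : Y x₃ (l * x₃ + ν) ≡ Λ * X x₃ + N
    line₃ = image-line on-third

    -- Since X x = x + 4B / x², the sum is s₁ + 4B (s₂² - 2 s₁ s₃) / s₃² in the elementary symmetric
    -- functions of the abscissae. Their values l², -2 l ν and d turn d² times it into l² (ν² +
    -- 3B)², which is (d Λ)².
    sum-X : X x₁ + X x₂ + X x₃ ≡ Λ * Λ
    sum-X = *-cancelˡ (*-nonzero d≢0 d≢0) (begin
      d * d * (X x₁ + X x₂ + X x₃)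
        ≡⟨ cong (λ z → z * z * (X x₁ + X x₂ + X x₃)) e₃ ⟨
      x₁ * x₂ * x₃ * (x₁ * x₂ * x₃) * (X x₁ + X x₂ + X x₃)
        ≡⟨ clear x₃ (x≢0 on-third) ⟩
      (x₁ + x₂ + x₃) * (x₁ * x₂ * x₃ * (x₁ * x₂ * x₃)) + # 4 * B *
        ((x₁ * x₂ + x₃ * (x₁ + x₂)) * (x₁ * x₂ + x₃ * (x₁ + x₂)) - # 2 * ((x₁ + x₂ + x₃) * (x₁ * x₂ * x₃)))
        ≡⟨ cong₂ _+_ (cong₂ _*_ e₁ (cong₂ _*_ e₃ e₃))
             (cong (# 4 * B *_) (cong₂ _-_ (cong₂ _*_ e₂ e₂) (cong (# 2 *_) (cong₂ _*_ e₁ e₃)))) ⟩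
      l * l * (d * d) + # 4 * B * (- (# 2 * (l * ν)) * - (# 2 * (l * ν)) - # 2 * (l * l * d))
        ≡⟨ solve 3 (λ B l ν →
            l :* l :* ((ν :* ν :- B) :* (ν :* ν :- B))
              :+ con (+ 4) :* B :* (:- (con (+ 2) :* (l :* ν)) :* (:- (con (+ 2) :* (l :* ν))) :- con (+ 2) :* (l :* l :* (ν :* ν :- B))) :=
            l :* (ν :* ν :+ con (+ 3) :* B) :* (l :* (ν :* ν :+ con (+ 3) :* B))) refl B l ν ⟩
      l * (ν * ν + # 3 * B) * (l * (ν * ν + # 3 * B))
        ≡⟨ cong₂ _*_ (*-/ d≢0 _) (*-/ d≢0 _) ⟨
      d * Λ * (d * Λ)
        ≡⟨ solve 2 (λ d a →
            d :* a :* (d :* a) :=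
            d :* d :* (a :* a)) refl d Λ ⟩
      d * d * (Λ * Λ) ∎)
      where
      open ≡-Reasoning
      -- The identity holds for any nonzero third abscissa, so x₃ is made a free variable here.
      clear : ∀ x₃ → x₃ ≢ 0# →
        x₁ * x₂ * x₃ * (x₁ * x₂ * x₃) * (X x₁ + X x₂ + X x₃) ≡
        (x₁ + x₂ + x₃) * (x₁ * x₂ * x₃ * (x₁ * x₂ * x₃)) + # 4 * B *
          ((x₁ * x₂ + x₃ * (x₁ + x₂)) * (x₁ * x₂ + x₃ * (x₁ + x₂)) - # 2 * ((x₁ + x₂ + x₃) * (x₁ * x₂ * x₃)))
      clear x₃ x₃≢0 = begin
        x₁ * x₂ * x₃ * (x₁ * x₂ * x₃) * (X x₁ + X x₂ + X x₃)
          ≡⟨ solve 6 (λ x₁ x₂ x₃ a b c →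
              x₁ :* x₂ :* x₃ :* (x₁ :* x₂ :* x₃) :* (a :+ b :+ c) :=
              x₂ :* x₃ :* (x₂ :* x₃) :* (x₁ :* x₁ :* a)
                :+ x₁ :* x₃ :* (x₁ :* x₃) :* (x₂ :* x₂ :* b)
                :+ x₁ :* x₂ :* (x₁ :* x₂) :* (x₃ :* x₃ :* c)) refl x₁ x₂ x₃ (X x₁) (X x₂) (X x₃) ⟩
        x₂ * x₃ * (x₂ * x₃) * (x₁ * x₁ * X x₁) + x₁ * x₃ * (x₁ * x₃) * (x₂ * x₂ * X x₂)
          + x₁ * x₂ * (x₁ * x₂) * (x₃ * x₃ * X x₃)
          ≡⟨ cong₂ _+_ (cong₂ _+_ (cong (x₂ * x₃ * (x₂ * x₃) *_) (X-eq (x≢0 on₁)))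
                                  (cong (x₁ * x₃ * (x₁ * x₃) *_) (X-eq (x≢0 on₂))))
                       (cong (x₁ * x₂ * (x₁ * x₂) *_) (X-eq x₃≢0)) ⟩
        x₂ * x₃ * (x₂ * x₃) * (x₁ * x₁ * x₁ + # 4 * B) + x₁ * x₃ * (x₁ * x₃) * (x₂ * x₂ * x₂ + # 4 * B)
          + x₁ * x₂ * (x₁ * x₂) * (x₃ * x₃ * x₃ + # 4 * B)
          ≡⟨ solve 4 (λ B x₁ x₂ x₃ →
              x₂ :* x₃ :* (x₂ :* x₃) :* (x₁ :* x₁ :* x₁ :+ con (+ 4) :* B)
                :+ x₁ :* x₃ :* (x₁ :* x₃) :* (x₂ :* x₂ :* x₂ :+ con (+ 4) :* B)
                :+ x₁ :* x₂ :* (x₁ :* x₂) :* (x₃ :* x₃ :* x₃ :+ con (+ 4) :* B) :=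
              (x₁ :+ x₂ :+ x₃) :* (x₁ :* x₂ :* x₃ :* (x₁ :* x₂ :* x₃))
                :+ con (+ 4) :* B :* ((x₁ :* x₂ :+ x₃ :* (x₁ :+ x₂)) :* (x₁ :* x₂ :+ x₃ :* (x₁ :+ x₂)) :- con (+ 2) :* ((x₁ :+ x₂ :+ x₃) :* (x₁ :* x₂ :* x₃)))) refl B x₁ x₂ x₃ ⟩
        (x₁ + x₂ + x₃) * (x₁ * x₂ * x₃ * (x₁ * x₂ * x₃)) + # 4 * B *
          ((x₁ * x₂ + x₃ * (x₁ + x₂)) * (x₁ * x₂ + x₃ * (x₁ + x₂)) - # 2 * ((x₁ + x₂ + x₃) * (x₁ * x₂ * x₃))) ∎

    X-third : thirdX Λ (X x₁) (X x₂) ≡ X x₃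
    X-third = mod (- # 1) sum-X (solve 4 (λ a p q r →
        a :* a :- p :- q
          :+ :- (con (+ 1)) :* (a :* a) :=
        r
          :+ :- (con (+ 1)) :* (p :+ q :+ r)) refl Λ (X x₁) (X x₂) (X x₃))

    -- By `X-third` and `line₃` the third point of the image line is the image of the third point of
    -- the line. The final reflection commutes with the map because `Y` is odd in y.
    addSlope-image : addSlope Λ (image (x₁ , y₁)) (image (x₂ , y₂)) ≡ image (addSlope l (x₁ , y₁) (x₂ , y₂))
    addSlope-image = cong₂ _,_ X-third (begin
      Λ * (X x₁ - thirdX Λ (X x₁) (X x₂)) - Y x₁ y₁
        ≡⟨ cong₂ (λ x y → Λ * (X x₁ - x) - y) X-third line₁ ⟩
      Λ * (X x₁ - X x₃) - (Λ * X x₁ + N)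
        ≡⟨ solve 4 (λ a p r n →
            a :* (p :- r) :- (a :* p :+ n) :=
            :- (a :* r :+ n)) refl Λ (X x₁) (X x₃) N ⟩
      - (Λ * X x₃ + N)            ≡⟨ cong -_ line₃ ⟨
      - Y x₃ (l * x₃ + ν)         ≡⟨ Y-neg x₃ _ ⟨
      Y x₃ (- (l * x₃ + ν))       ≡⟨ cong (Y x₃) third-neg ⟨
      Y x₃ (l * (x₁ - x₃) - y₁)   ∎)
      where open ≡-Reasoning

  -- Needed so that a tangent that is not vertical has an image that is not vertical.
  Y≢0 : ∀ {x y} → OnCurve B x y → y ≢ 0# → Y x y ≢ 0#
  Y≢0 {x} {y} on y≢0 = /-nonzero (*-nonzero y≢0 x³-8B≢0) (*-nonzero (*-nonzero x≢0′ x≢0′) x≢0′)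
    where
    open ≡-Reasoning
    x≢0′ = x≢0 on
    -- Otherwise y² = 9B.
    x³-8B≢0 : x * x * x - # 8 * B ≢ 0#
    x³-8B≢0 eq = B-nonsquare (y / # 3 , *-cancelˡ (*-nonzero 3≢0 3≢0) (begin
      # 3 * # 3 * (y / # 3 * (y / # 3))   ≡⟨ solve 1 (λ a →
          con (+ 3) :* (con (+ 3)) :* (a :* a) :=
          con (+ 3) :* a :* (con (+ 3) :* a)) refl (y / # 3) ⟩
      # 3 * (y / # 3) * (# 3 * (y / # 3)) ≡⟨ cong₂ _*_ (*-/ 3≢0 y) (*-/ 3≢0 y) ⟩
      y * y     ≡⟨ mod (# 1) on (mod (# 1) eq (solve 3 (λ B x y →
          y :* y
            :+ con (+ 1) :* (x :* x :* x :+ B)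
            :+ con (+ 1) :* (con (+ 0)) :=
          con (+ 3) :* (con (+ 3)) :* B
            :+ con (+ 1) :* (y :* y)
            :+ con (+ 1) :* (x :* x :* x :- con (+ 8) :* B)) refl B x y)) ⟩
      # 3 * # 3 * B  ∎))

  image-slope : ∀ {l P Q} → On B P → On B Q → Slope l P Q → ∃ λ l′ → Slope l′ (image P) (image Q)
                × addSlope l′ (image P) (image Q) ≡ image (addSlope l P Q)
  image-slope {l} on₁ on₂ s@(chord {x₁} {y₁} {x₂} {y₂} x₁≢x₂ _) =
    Λ , chord (x₁≢x₂ ∘ X-injective on₁ on₂) slope , addSlope-image
    where
    open ImageSlope on₁ on₂ s
    open ImageLine l (Vieta.ν on₁ on₂ s)
    slope : (X x₂ - X x₁) * Λ ≡ Y x₂ y₂ - Y x₁ y₁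
    slope = trans (solve 4 (λ a p q n →
        (q :- p) :* a :=
        a :* q :+ n :- (a :* p :+ n)) refl Λ (X x₁) (X x₂) N)
                  (sym (cong₂ _-_ line₂ line₁))
  image-slope {l} on₁ on₂ s@(tangent {x} {y} y≢-y eq) =
    Λ , tangent (x≢-x 2≢0 (Y≢0 on₁ y≢0)) slope , addSlope-image
    where
    open ≡-Reasoning
    open ImageSlope on₁ on₂ s
    open Vieta on₁ on₂ s using (ν)
    open ImageLine l ν
    y≢0 : y ≢ 0#
    y≢0 refl = y≢-y (sym -0#≈0#)
    x≢0′ = x≢0 on₁
    x³ = x * x * x

    -- 2 y ν = 2 y² - x · (2 y l), where y² = x³ + B and 2 y l = 3 x².
    2yν : # 2 * (y * ν) ≡ # 2 * B - x³
    2yν = mod (# 2) on₁ (mod (- x) eq (solve 4 (λ B l x y →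
        con (+ 2) :* (y :* (y :- l :* x))
          :+ con (+ 2) :* (x :* x :* x :+ B)
          :+ :- x :* (con (+ 3) :* x :* x) :=
        con (+ 2) :* B :- x :* x :* x
          :+ con (+ 2) :* (y :* y)
          :+ :- x :* (con (+ 2) :* y :* l)) refl B l x y))

    -- This is the tangent condition 2 Y Λ = 3 X² with denominators cleared and 2 y l replaced by 3
    -- x². Multiplying by (2y)² makes ν occur only in 2 y ν, whose value is known.
    numerators : x³ * (x³ - # 8 * B) * (ν * ν + # 3 * B) ≡ (x³ + # 4 * B) * (x³ + # 4 * B) * d
    numerators = cleared ν 2yν
      where
      cleared : ∀ ν → # 2 * (y * ν) ≡ # 2 * B - x³ →
        x³ * (x³ - # 8 * B) * (ν * ν + # 3 * B) ≡ (x³ + # 4 * B) * (x³ + # 4 * B) * (ν * ν - B)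
      cleared ν 2yν = *-cancelˡ (*-nonzero (*-nonzero 2≢0 y≢0) (*-nonzero 2≢0 y≢0)) (begin
        # 2 * y * (# 2 * y) * (x³ * (x³ - # 8 * B) * (ν * ν + # 3 * B))
          ≡⟨ solve 4 (λ B x y ν →
              con (+ 2) :* y :* (con (+ 2) :* y) :* (x :* x :* x :* (x :* x :* x :- con (+ 8) :* B) :* (ν :* ν :+ con (+ 3) :* B)) :=
              x :* x :* x :* (x :* x :* x :- con (+ 8) :* B)
                :* (con (+ 2) :* (y :* ν) :* (con (+ 2) :* (y :* ν)) :+ con (+ 12) :* B :* (y :* y))) refl B x y ν ⟩
        x³ * (x³ - # 8 * B) * (# 2 * (y * ν) * (# 2 * (y * ν)) + # 12 * B * (y * y))
          ≡⟨ cong₂ (λ s t → x³ * (x³ - # 8 * B) * (s * s + # 12 * B * t)) 2yν on₁ ⟩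
        x³ * (x³ - # 8 * B) * ((# 2 * B - x³) * (# 2 * B - x³) + # 12 * B * (x³ + B))
          -- The two long brackets are (t + 4B)² and t (t - 8B), so both sides are the same product.
          ≡⟨ solve 2 (λ B t →
              t :* (t :- con (+ 8) :* B) :* ((con (+ 2) :* B :- t) :* (con (+ 2) :* B :- t) :+ con (+ 12) :* B :* (t :+ B)) :=
              (t :+ con (+ 4) :* B) :* (t :+ con (+ 4) :* B)
                :* ((con (+ 2) :* B :- t) :* (con (+ 2) :* B :- t) :- con (+ 4) :* B :* (t :+ B))) refl B x³ ⟩
        (x³ + # 4 * B) * (x³ + # 4 * B) * ((# 2 * B - x³) * (# 2 * B - x³) - # 4 * B * (x³ + B))
          ≡⟨ cong₂ (λ s t → (x³ + # 4 * B) * (x³ + # 4 * B) * (s * s - # 4 * B * t)) 2yν on₁ ⟨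
        (x³ + # 4 * B) * (x³ + # 4 * B) * (# 2 * (y * ν) * (# 2 * (y * ν)) - # 4 * B * (y * y))
          ≡⟨ solve 4 (λ B x y ν →
              (x :* x :* x :+ con (+ 4) :* B) :* (x :* x :* x :+ con (+ 4) :* B)
                :* (con (+ 2) :* (y :* ν) :* (con (+ 2) :* (y :* ν)) :- con (+ 4) :* B :* (y :* y)) :=
              con (+ 2) :* y :* (con (+ 2) :* y) :* ((x :* x :* x :+ con (+ 4) :* B) :* (x :* x :* x :+ con (+ 4) :* B) :* (ν :* ν :- B))) refl B x y ν ⟩
        # 2 * y * (# 2 * y) * ((x³ + # 4 * B) * (x³ + # 4 * B) * (ν * ν - B)) ∎)

    slope : (2# * Y x y) * Λ ≡ 3# * X x * X x
    slope = *-cancelˡ (*-nonzero d≢0 (*-nonzero x≢0′ (*-nonzero (*-nonzero x≢0′ x≢0′) x≢0′))) (begin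
      d * (x * x³) * (2# * Y x y * Λ)
        ≡⟨ solve 4 (λ d a x b →
            d :* (x :* (x :* x :* x)) :* (con (+ 2) :* b :* a) :=
            d :* a :* (x :* (con (+ 2) :* (x :* x :* x :* b)))) refl d Λ x (Y x y) ⟩
      d * Λ * (x * (# 2 * (x³ * Y x y)))
        ≡⟨ cong₂ (λ s t → s * (x * (# 2 * t))) (*-/ d≢0 _) (Y-eq x≢0′ y) ⟩
      l * (ν * ν + # 3 * B) * (x * (# 2 * (y * (x³ - # 8 * B))))
        ≡⟨ solve 5 (λ l x y a b →
            l :* b :* (x :* (con (+ 2) :* (y :* a))) :=
            con (+ 2) :* y :* l :* (x :* (a :* b))) refl l x y (x³ - # 8 * B) (ν * ν + # 3 * B) ⟩
      2# * y * l * (x * ((x³ - # 8 * B) * (ν * ν + # 3 * B)))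
        ≡⟨ cong (_* (x * ((x³ - # 8 * B) * (ν * ν + # 3 * B)))) eq ⟩
      3# * x * x * (x * ((x³ - # 8 * B) * (ν * ν + # 3 * B)))
        ≡⟨ solve 3 (λ x a b →
            con (+ 3) :* x :* x :* (x :* (a :* b)) :=
            con (+ 3) :* (x :* x :* x :* a :* b)) refl x (x³ - # 8 * B) (ν * ν + # 3 * B) ⟩
      3# * (x³ * (x³ - # 8 * B) * (ν * ν + # 3 * B))
        ≡⟨ cong (3# *_) numerators ⟩
      3# * ((x³ + # 4 * B) * (x³ + # 4 * B) * d)
        ≡⟨ cong (λ z → 3# * (z * z * d)) (X-eq x≢0′) ⟨
      3# * (x * x * X x * (x * x * X x) * d)
        ≡⟨ solve 3 (λ d x a →
            con (+ 3) :* (x :* x :* a :* (x :* x :* a) :* d) :=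
            d :* (x :* (x :* x :* x)) :* (con (+ 3) :* a :* a)) refl d x (X x) ⟩
      d * (x * x³) * (3# * X x * X x) ∎)

  isogeny : AffineHom B B′
  isogeny = record
    { f = image ; f-on = image-on ; f-neg = λ (x , y) → cong (X x ,_) (Y-neg x y) ; f-slope = image-slope }

-- Characteristic p and the Frobenius endomorphism.

module Frobenius (F : FiniteField) where
  open FiniteField F
  open Field F
  open import Algebra.Properties.CommutativeSemiring.Exp commutativeSemiring
    using (^-distrib-*; ^-assocʳ) renaming (_^_ to _↑_)
  open import Algebra.Properties.CommutativeSemiring.Binomial commutativeSemiring
    using (binomialTerm) renaming (theorem to binomial-theorem)
  open import Algebra.Properties.Semiring.Sum semiring
    using (sum; sum-init-last; sum-cong-≋; sum-replicate-zero)
  open import Algebra.Properties.Semiring.Mult semiring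
    using (×-assoc-*; ×-homo-1) renaming (_×_ to _·_)
  open import Algebra.Properties.Semiring.Mult.TCOptimised semiring using (×ᵤ≈×)

  -- This collects what a twisted scaling needs of the Frobenius; with `identity` the same
  -- construction gives the ordinary scalings.
  record Endomorphism : Set where
    field
      σ   : Carrier → Carrier
      σ-+ : ∀ x y → σ (x + y) ≡ σ x + σ y
      σ-* : ∀ x y → σ (x * y) ≡ σ x * σ y
      σ-1 : σ 1# ≡ 1#

    σ-0 : σ 0# ≡ 0#
    σ-0 = +-cancelˡ (σ 0#) _ _ (trans (sym (σ-+ 0# 0#)) (trans (cong σ (+-identityˡ 0#)) (sym (+-identityʳ (σ 0#)))))

    σ-neg : ∀ x → σ (- x) ≡ - σ x
    σ-neg x = +-cancelˡ (σ x) _ _ (trans (sym (σ-+ x (- x)))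
      (trans (cong σ (-‿inverseʳ x)) (trans σ-0 (sym (-‿inverseʳ (σ x))))))

    σ-sub : ∀ x y → σ (x - y) ≡ σ x - σ y
    σ-sub x y = trans (σ-+ x (- y)) (cong (λ z → σ x + z) (σ-neg y))

    σ-nonzero : ∀ {x} → x ≢ 0# → σ x ≢ 0#
    σ-nonzero {x} x≢0 σx≡0 = nonzero-1 (begin
      1#              ≡⟨ σ-1 ⟨
      σ 1#            ≡⟨ cong σ (inverse x x≢0) ⟨
      σ (x * x ⁻¹)    ≡⟨ σ-* x (x ⁻¹) ⟩
      σ x * σ (x ⁻¹)  ≡⟨ cong (_* σ (x ⁻¹)) σx≡0 ⟩
      0# * σ (x ⁻¹)   ≡⟨ zeroˡ _ ⟩
      0#              ∎)
      where open ≡-Reasoning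

    σ-injective : ∀ {x y} → σ x ≡ σ y → x ≡ y
    σ-injective {x} {y} eq with (x - y) ≟ 0#
    ... | yes x-y≡0 = mod-zero x-y≡0
    ... | no x-y≢0 = contradiction (trans (σ-sub x y) (sub-zero eq)) (σ-nonzero x-y≢0)

  identity : Endomorphism
  identity = record { σ = id ; σ-+ = λ _ _ → refl ; σ-* = λ _ _ → refl ; σ-1 = refl }

  #-* : ∀ m n → # (m ℕ.* n) ≡ # m * # n
  #-* m n = trans (cong ι (ℤ.pos-* m n)) (ι-* (+ m) (+ n))

  #-+ : ∀ m n → # (m ℕ.+ n) ≡ # m + # n
  #-+ m n = ι-+ (+ m) (+ n)

  Σ : List Carrier → Carrier
  Σ = foldr _+_ 0#

  Σ-shift : ∀ xs → Σ (map (_+_ 1#) xs) ≡ Σ xs + # (length xs)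
  Σ-shift [] = sym (+-identityˡ 0#)
  Σ-shift (x ∷ xs) = begin
    1# + x + Σ (map (_+_ 1#) xs)        ≡⟨ cong (λ z → 1# + x + z) (Σ-shift xs) ⟩
    1# + x + (Σ xs + # (length xs))     ≡⟨ solve 3 (λ x s n →
        con (+ 1) :+ x :+ (s :+ n) :=
        x :+ s :+ (con (+ 1) :+ n)) refl x (Σ xs) (# (length xs)) ⟩
    x + Σ xs + (# 1 + # (length xs))    ≡⟨ cong (λ z → x + Σ xs + z) (#-+ 1 (length xs)) ⟨
    x + Σ xs + # (suc (length xs))      ∎
    where open ≡-Reasoning

  shift-↭ : map (_+_ 1#) elements ↭ elements
  shift-↭ = ∼bag⇒↭ (unique∧set⇒bag (Unique.map⁺ (λ {x} {y} → +-cancelˡ 1# x y) unique) unique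
    (λ {x} → mk⇔ (λ _ → complete x)
      (λ _ → subst (_∈ _) (solve 1 (λ x →
          con (+ 1) :+ (x :- con (+ 1)) :=
          x) refl x) (∈-map⁺ (_+_ 1#) (complete (x - 1#))))))

  -- The sum of all elements is invariant under translation by 1.
  #size≡0 : # size ≡ 0#
  #size≡0 = +-cancelˡ (Σ elements) _ _ (trans (sym (Σ-shift elements))
    (trans (Permutation.foldr-commMonoid (setoid Carrier) +-isCommutativeMonoid (↭⇒↭ₛ shift-↭))
      (sym (+-identityʳ _))))
    where open CommutativeRing commutativeRing using (+-isCommutativeMonoid)

  #^≡0⇒#≡0 : ∀ p k → # (p ^ k) ≡ 0# → # p ≡ 0#
  #^≡0⇒#≡0 p zero    eq = contradiction eq nonzero-1
  #^≡0⇒#≡0 p (suc k) eq with integral-⊎ (trans (sym (#-* p (p ^ k))) eq)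
  ... | inj₁ #p≡0 = #p≡0
  ... | inj₂ rest = #^≡0⇒#≡0 p k rest

  multiple·≡0 : ∀ {p n} → # p ≡ 0# → p ∣ n → ∀ x → n · x ≡ 0#
  multiple·≡0 {p} #p≡0 (divides q refl) x = begin
    (q ℕ.* p) · x          ≡⟨ cong ((q ℕ.* p) ·_) (*-identityˡ x) ⟨
    (q ℕ.* p) · (1# * x)   ≡⟨ ×-assoc-* (q ℕ.* p) 1# x ⟨
    (q ℕ.* p) · 1# * x     ≡⟨ cong (_* x) (×ᵤ≈× (q ℕ.* p) 1#) ⟩
    # (q ℕ.* p) * x        ≡⟨ cong (_* x) (trans (#-* q p) (trans (cong (# q *_) #p≡0) (zeroʳ _))) ⟩
    0# * x                 ≡⟨ zeroˡ x ⟩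
    0#                     ∎
    where open ≡-Reasoning

  frobenius-+ : ∀ {p} → Prime p → # p ≡ 0# → ∀ x y → (x + y) ↑ p ≡ x ↑ p + y ↑ p
  frobenius-+ {zero}  pr #p≡0 x y = contradiction pr λ ()
  frobenius-+ {suc p} pr #p≡0 x y = begin
    (x + y) ↑ suc p                                  ≡⟨ binomial-theorem (suc p) x y ⟩
    -- The two end terms are split off. The middle ones have lower index strictly between 0 and the
    -- prime, so their binomial coefficients vanish in F.
    t zero + sum (t ∘ suc)                           ≡⟨ cong (λ z → t zero + z) (sum-init-last (t ∘ suc)) ⟩
    t zero + (sum (t ∘ suc ∘ inject₁) + t (suc (fromℕ p)))
      ≡⟨ cong₂ (λ a b → a + (b + t (suc (fromℕ p)))) first middle ⟩
    y ↑ suc p + (0# + t (suc (fromℕ p)))             ≡⟨ cong (λ a → y ↑ suc p + (0# + a)) last ⟩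
    y ↑ suc p + (0# + x ↑ suc p)                     ≡⟨ solve 2 (λ a b →
        b :+ (con (+ 0) :+ a) :=
        a :+ b) refl (x ↑ suc p) (y ↑ suc p) ⟩
    x ↑ suc p + y ↑ suc p                            ∎
    where
    open ≡-Reasoning
    t : Fin (suc (suc p)) → Carrier
    t = binomialTerm x y (suc p)
    first : t zero ≡ y ↑ suc p
    first = trans (×-homo-1 _) (*-identityˡ _)
    middle : sum (t ∘ suc ∘ inject₁) ≡ 0#
    middle = trans (sum-cong-≋ vanish) (sum-replicate-zero p)
      where
      vanish : ∀ i → t (suc (inject₁ i)) ≡ 0#
      vanish i = multiple·≡0 #p≡0
        (prime∣nCk pr (subst (_< p) (sym (toℕ-inject₁ i)) (toℕ<n i))) _
    last : t (suc (fromℕ p)) ≡ x ↑ suc p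
    last rewrite toℕ-fromℕ p | nCn≡1 (suc p) | ℕ.n∸n≡0 p = trans (×-homo-1 _) (*-identityʳ _)

  1^ : ∀ n → 1# ↑ n ≡ 1#
  1^ zero    = refl
  1^ (suc n) = trans (*-identityˡ _) (1^ n)

  frobenius : ∀ {p} → Prime p → # p ≡ 0# → Endomorphism
  frobenius {p} pr #p≡0 = record
    { σ = _↑ p ; σ-+ = frobenius-+ pr #p≡0 ; σ-* = λ x y → ^-distrib-* x y p ; σ-1 = 1^ p }

  odd-power-* : ∀ {p} s → p ≡ 1 ℕ.+ s ℕ.* 2 → ∀ x → IsSquare (x ↑ p * x)
  -- The exponent comes from p + 1 = 2 (s + 1).
  odd-power-* {p} s refl x = x ↑ suc s , (begin
    x * x ↑ s * (x * x ↑ s)    ≡⟨ solve 2 (λ x a →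
        x :* a :* (x :* a) :=
        x :* (a :* (a :* (con (+ 1)))) :* x) refl x (x ↑ s) ⟩
    x * (x ↑ s) ↑ 2 * x        ≡⟨ cong (λ z → x * z * x) (^-assocʳ x s 2) ⟩
    x * x ↑ (s ℕ.* 2) * x      ∎)
    where open ≡-Reasoning

  2-mod-3-power-* : ∀ {p} s → p ≡ 2 ℕ.+ s ℕ.* 3 → ∀ x → IsCube (x ↑ p * x)
  -- The exponent comes from p + 1 = 3 (s + 1).
  2-mod-3-power-* {p} s refl x = x ↑ suc s , (begin
    x * x ↑ s * (x * x ↑ s) * (x * x ↑ s) ≡⟨ solve 2 (λ x a →
        x :* a :* (x :* a) :* (x :* a) :=
        x :* (x :* (a :* (a :* (a :* (con (+ 1)))))) :* x) refl x (x ↑ s) ⟩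
    x * (x * (x ↑ s) ↑ 3) * x             ≡⟨ cong (λ z → x * (x * z) * x) (^-assocʳ x s 3) ⟩
    x * (x * x ↑ (s ℕ.* 3)) * x           ∎)
    where open ≡-Reasoning

-- Scalings composed with a field endomorphism.

module Twist (F : FiniteField) where
  open FiniteField F
  open Curve F
  open Field F
  open AffineMaps F
  open Frobenius F

  -- Applying σ to both coordinates leads to the curve of σ B, and the scaling by u² and u³ leads on
  -- to that of u⁶ σ B. A slope l becomes u σ l, the ratio of the two scalings being u.
  twist : ∀ (s : Endomorphism) {B B′ u} → u ≢ 0# →
    B′ ≡ u * u * u * (u * u * u) * Endomorphism.σ s B → AffineHom B B′
  twist s {B} {B′} {u} u≢0 refl = record
    { f = f ; f-on = f-on
    ; f-neg = λ (x , y) → cong (u² * σ x ,_) (trans (cong (u³ *_) (σ-neg y)) (solve 2 (λ u y →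
        u :* (:- y) :=
        :- (u :* y)) refl u³ (σ y)))
    ; f-slope = f-slope }
    where
    open Endomorphism s
    open ≡-Reasoning
    u² = u * u
    u³ = u * u * u
    u²≢0 = *-nonzero u≢0 u≢0
    u³≢0 = *-nonzero u²≢0 u≢0

    f : Affine → Affine
    f (x , y) = u² * σ x , u³ * σ y

    σ-on : ∀ {x y} → OnCurve B x y → OnCurve (σ B) (σ x) (σ y)
    σ-on {x} {y} on = begin
      σ y * σ y             ≡⟨ σ-* y y ⟨
      σ (y * y)             ≡⟨ cong σ on ⟩
      σ (x * x * x + B)     ≡⟨ σ-+ _ _ ⟩
      σ (x * x * x) + σ B   ≡⟨ cong (_+ σ B) (trans (σ-* _ _) (cong (_* σ x) (σ-* x x))) ⟩
      σ x * σ x * σ x + σ B ∎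

    f-on : ∀ {P} → On B P → On (u³ * u³ * σ B) (f P)
    f-on {x , y} on = mod (u * u * u * (u * u * u)) (σ-on on) (solve 4 (λ u b x y →
        u :* u :* u :* y :* (u :* u :* u :* y)
          :+ u :* u :* u :* (u :* u :* u) :* (x :* x :* x :+ b) :=
        u :* u :* x :* (u :* u :* x) :* (u :* u :* x) :+ u :* u :* u :* (u :* u :* u) :* b
          :+ u :* u :* u :* (u :* u :* u) :* (y :* y)) refl u (σ B) (σ x) (σ y))

    σ-thirdX : ∀ l x₁ x₂ → σ (thirdX l x₁ x₂) ≡ thirdX (σ l) (σ x₁) (σ x₂)
    σ-thirdX l x₁ x₂ = trans (σ-sub _ x₂) (cong (_- σ x₂) (trans (σ-sub _ x₁) (cong (_- σ x₁) (σ-* l l))))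

    f-thirdX : ∀ l x₁ x₂ → thirdX (u * σ l) (u² * σ x₁) (u² * σ x₂) ≡ u² * σ (thirdX l x₁ x₂)
    f-thirdX l x₁ x₂ = trans (solve 4 (λ u l x₁ x₂ →
        u :* l :* (u :* l) :- u :* u :* x₁ :- u :* u :* x₂ :=
        u :* u :* (l :* l :- x₁ :- x₂)) refl u (σ l) (σ x₁) (σ x₂))
      (cong (u² *_) (sym (σ-thirdX l x₁ x₂)))

    f-addSlope : ∀ l P Q → addSlope (u * σ l) (f P) (f Q) ≡ f (addSlope l P Q)
    f-addSlope l (x₁ , y₁) (x₂ , y₂) = cong₂ _,_ (f-thirdX l x₁ x₂) (begin
      u * σ l * (u² * σ x₁ - thirdX (u * σ l) (u² * σ x₁) (u² * σ x₂)) - u³ * σ y₁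
        ≡⟨ cong (λ x → u * σ l * (u² * σ x₁ - x) - u³ * σ y₁) (f-thirdX l x₁ x₂) ⟩
      u * σ l * (u² * σ x₁ - u² * σ x₃) - u³ * σ y₁
        ≡⟨ solve 5 (λ u l x₁ x₃ y →
            u :* l :* (u :* u :* x₁ :- u :* u :* x₃) :- u :* u :* u :* y :=
            u :* u :* u :* (l :* (x₁ :- x₃) :- y)) refl u (σ l) (σ x₁) (σ x₃) (σ y₁) ⟩
      u³ * (σ l * (σ x₁ - σ x₃) - σ y₁)
        ≡⟨ cong (λ z → u³ * (σ l * z - σ y₁)) (σ-sub x₁ x₃) ⟨
      u³ * (σ l * σ (x₁ - x₃) - σ y₁)
        ≡⟨ cong (λ z → u³ * (z - σ y₁)) (σ-* l (x₁ - x₃)) ⟨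
      u³ * (σ (l * (x₁ - x₃)) - σ y₁)
        ≡⟨ cong (u³ *_) (σ-sub _ y₁) ⟨
      u³ * σ (l * (x₁ - x₃) - y₁) ∎)
      where x₃ = thirdX l x₁ x₂

    f-slope : ∀ {l P Q} → On B P → On B Q → Slope l P Q →
              ∃ λ l′ → Slope l′ (f P) (f Q) × addSlope l′ (f P) (f Q) ≡ f (addSlope l P Q)
    f-slope {l} {P} {Q} _ _ (chord {x₁} {y₁} {x₂} {y₂} x₁≢x₂ eq) =
      u * σ l , chord (x₁≢x₂ ∘ σ-injective ∘ *-cancelˡ u²≢0) (begin
        (u² * σ x₂ - u² * σ x₁) * (u * σ l) ≡⟨ solve 4 (λ u l x₁ x₂ →
            (u :* u :* x₂ :- u :* u :* x₁) :* (u :* l) :=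
            u :* u :* u :* ((x₂ :- x₁) :* l)) refl u (σ l) (σ x₁) (σ x₂) ⟩
        u³ * ((σ x₂ - σ x₁) * σ l)          ≡⟨ cong (λ z → u³ * (z * σ l)) (σ-sub x₂ x₁) ⟨
        u³ * (σ (x₂ - x₁) * σ l)            ≡⟨ cong (u³ *_) (σ-* (x₂ - x₁) l) ⟨
        u³ * σ ((x₂ - x₁) * l)              ≡⟨ cong (λ z → u³ * σ z) eq ⟩
        u³ * σ (y₂ - y₁)                    ≡⟨ cong (u³ *_) (σ-sub y₂ y₁) ⟩
        u³ * (σ y₂ - σ y₁)                  ≡⟨ solve 3 (λ u a b →
            u :* (a :- b) :=
            u :* a :- u :* b) refl u³ (σ y₂) (σ y₁) ⟩
        u³ * σ y₂ - u³ * σ y₁               ∎) , f-addSlope l P Q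
    f-slope {l} {P} {Q} _ _ (tangent {x} {y} y≢-y eq) =
      u * σ l , tangent (y≢-y ∘ σ-injective ∘ *-cancelˡ u³≢0 ∘ λ e → trans e neg-out) (begin
        2# * (u³ * σ y) * (u * σ l)         ≡⟨ solve 3 (λ u l y →
            con (+ 2) :* (u :* u :* u :* y) :* (u :* l) :=
            u :* u :* (u :* u) :* (con (+ 2) :* y :* l)) refl u (σ l) (σ y) ⟩
        u² * u² * (2# * σ y * σ l)          ≡⟨ cong (u² * u² *_) (sym σ-2yl) ⟩
        u² * u² * σ (2# * y * l)            ≡⟨ cong (λ z → u² * u² * σ z) eq ⟩
        u² * u² * σ (3# * x * x)            ≡⟨ cong (u² * u² *_) σ-3xx ⟩
        u² * u² * (3# * σ x * σ x)          ≡⟨ solve 2 (λ u x →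
            u :* u :* (u :* u) :* (con (+ 3) :* x :* x) :=
            con (+ 3) :* (u :* u :* x) :* (u :* u :* x)) refl u (σ x) ⟩
        3# * (u² * σ x) * (u² * σ x)        ∎) , f-addSlope l P Q
      where
      neg-out : - (u³ * σ y) ≡ u³ * σ (- y)
      neg-out = trans (solve 2 (λ u y →
          :- (u :* y) :=
          u :* (:- y)) refl u³ (σ y)) (cong (u³ *_) (sym (σ-neg y)))
      σ-2 : σ 2# ≡ 2#
      σ-2 = trans (σ-+ 1# 1#) (cong₂ _+_ σ-1 σ-1)
      σ-3 : σ 3# ≡ 3#
      σ-3 = trans (σ-+ 2# 1#) (cong₂ _+_ σ-2 σ-1)
      σ-2yl : σ (2# * y * l) ≡ 2# * σ y * σ l
      σ-2yl = trans (σ-* _ l) (cong (_* σ l) (trans (σ-* 2# y) (cong (_* σ y) σ-2)))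
      σ-3xx : σ (3# * x * x) ≡ 3# * σ x * σ x
      σ-3xx = trans (σ-* _ x) (cong (_* σ x) (trans (σ-* 3# x) (cong (_* σ x) σ-3)))

-- Squares, cubes and sixth powers in a finite field.

module Residues (F : FiniteField) where
  open FiniteField F
  open Field F

  exists? : {P : Carrier → Set} → Decidable P → Dec (∃ P)
  exists? P? = Dec.map′ satisfied (λ (x , px) → lose (complete x) px) (any? P? elements)

  isSquare? : Decidable IsSquare
  isSquare? a = exists? (λ t → (t * t) ≟ a)

  isCube? : Decidable IsCube
  isCube? a = exists? (λ t → (t * t * t) ≟ a)

  count : {P : Carrier → Set} (P? : Decidable P) (zs : List Carrier) → Unique zs →
    (∀ {z} → P z → z ∈ zs) → (∀ {z} → z ∈ zs → P z) → length (filter P? elements) ≡ length zs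
  count P? zs zs! P⇒∈ ∈⇒P = Unique-≡-length (Unique.filter⁺ P? unique) zs!
    (λ z∈ → P⇒∈ (proj₂ (∈-filter⁻ P? {xs = elements} z∈)))
    (λ z∈ → ∈-filter⁺ P? (complete _) (∈⇒P z∈))

  IsSquare-* : ∀ {a b} → IsSquare a → IsSquare b → IsSquare (a * b)
  IsSquare-* (s , refl) (t , refl) = s * t , (solve 2 (λ s t →
      s :* t :* (s :* t) :=
      s :* s :* (t :* t)) refl s t)

  IsCube-* : ∀ {a b} → IsCube a → IsCube b → IsCube (a * b)
  IsCube-* (s , refl) (t , refl) = s * t , (solve 2 (λ s t →
      s :* t :* (s :* t) :* (s :* t) :=
      s :* s :* s :* (t :* t :* t)) refl s t)

  IsSquare-cancel : ∀ {a c} → c ≢ 0# → IsSquare (a * (c * c)) → IsSquare a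
  IsSquare-cancel {a} {c} c≢0 (t , eq) = t / c , *-cancelˡ (*-nonzero c≢0 c≢0) (begin
    c * c * (t / c * (t / c))   ≡⟨ solve 2 (λ c r →
        c :* c :* (r :* r) :=
        c :* r :* (c :* r)) refl c (t / c) ⟩
    c * (t / c) * (c * (t / c)) ≡⟨ cong (λ z → z * z) (*-/ c≢0 t) ⟩
    t * t                       ≡⟨ eq ⟩
    a * (c * c)                 ≡⟨ *-comm a (c * c) ⟩
    c * c * a                   ∎)
    where open ≡-Reasoning

  IsCube-cancel : ∀ {a c} → c ≢ 0# → IsCube (a * (c * c * c)) → IsCube a
  IsCube-cancel {a} {c} c≢0 (t , eq) = t / c , *-cancelˡ (*-nonzero (*-nonzero c≢0 c≢0) c≢0) (begin
    c * c * c * (t / c * (t / c) * (t / c))       ≡⟨ solve 2 (λ c r →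
        c :* c :* c :* (r :* r :* r) :=
        c :* r :* (c :* r) :* (c :* r)) refl c (t / c) ⟩
    c * (t / c) * (c * (t / c)) * (c * (t / c))   ≡⟨ cong (λ z → z * z * z) (*-/ c≢0 t) ⟩
    t * t * t                                     ≡⟨ eq ⟩
    a * (c * c * c)                               ≡⟨ *-comm a (c * c * c) ⟩
    c * c * c * a                                 ∎)
    where open ≡-Reasoning

  -- If v² = r = w³ then r = (v / w)⁶.
  sixth-power : ∀ {r} → r ≢ 0# → IsSquare r → IsCube r →
    ∃ λ u → u ≢ 0# × u * u * u * (u * u * u) ≡ r
  sixth-power {r} r≢0 (v , v²) (w , w³) = u , u≢0 , trans (cong (λ z → z * z) u³≡v) v²
    where
    open ≡-Reasoning
    w≢0 : w ≢ 0#
    w≢0 refl = r≢0 (trans (sym w³) (zeroʳ _))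
    v≢0 : v ≢ 0#
    v≢0 refl = r≢0 (trans (sym v²) (zeroʳ _))
    u = v / w
    u≢0 = /-nonzero v≢0 w≢0
    u³≡v : u * u * u ≡ v
    u³≡v = *-cancelˡ r≢0 (begin
      r * (u * u * u)             ≡⟨ cong (_* (u * u * u)) w³ ⟨
      w * w * w * (u * u * u)     ≡⟨ solve 2 (λ w u →
          w :* w :* w :* (u :* u :* u) :=
          w :* u :* (w :* u) :* (w :* u)) refl w u ⟩
      w * u * (w * u) * (w * u)   ≡⟨ cong (λ z → z * z * z) (*-/ w≢0 v) ⟩
      v * v * v                   ≡⟨ cong (_* v) v² ⟩
      r * v                       ∎)

  -- The quotient b / a agrees with b a up to the square a² and with b a² up to the cube a³, so the
  -- two hypotheses make it both a square and a cube.
  sixth-power-multiple : ∀ {a b} → a ≢ 0# → b ≢ 0# → IsSquare (b * a) → IsCube (b * (a * a)) →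
    ∃ λ u → u ≢ 0# × b ≡ u * u * u * (u * u * u) * a
  sixth-power-multiple {a} {b} a≢0 b≢0 sq cu
    = let u , u≢0 , u⁶ = sixth-power (/-nonzero b≢0 a≢0)
            (IsSquare-cancel {b / a} a≢0 (subst IsSquare (sym square-eq) sq))
            (IsCube-cancel {b / a} a≢0 (subst IsCube (sym cube-eq) cu))
      in u , u≢0 , sym (trans (cong (_* a) u⁶) (trans (*-comm (b / a) a) (*-/ a≢0 b)))
    where
    square-eq : b / a * (a * a) ≡ b * a
    square-eq = trans (solve 2 (λ a r →
        r :* (a :* a) :=
        a :* r :* a) refl a (b / a)) (cong (_* a) (*-/ a≢0 b))
    cube-eq : b / a * (a * a * a) ≡ b * (a * a)
    cube-eq = trans (solve 2 (λ a r →
        r :* (a :* a :* a) :=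
        a :* r :* (a :* a)) refl a (b / a)) (cong (_* (a * a)) (*-/ a≢0 b))

  nonzeros : List Carrier
  nonzeros = filter (λ x → ¬? (x ≟ 0#)) elements

  ∈-nonzeros⁺ : ∀ {x} → x ≢ 0# → x ∈ nonzeros
  ∈-nonzeros⁺ x≢0 = ∈-filter⁺ _ (complete _) x≢0

  ∈-nonzeros⁻ : ∀ {x} → x ∈ nonzeros → x ≢ 0#
  ∈-nonzeros⁻ x∈ = proj₂ (∈-filter⁻ (λ x → ¬? (x ≟ 0#)) {xs = elements} x∈)

  -- On pairwise disjoint cosets c · g(F*) of an at most n-to-1 map g, the map
  -- (c , x) ↦ c g(x) is at most n-to-1 as well.
  module Cosets (g : Carrier → Carrier) (g-nonzero : ∀ {x} → x ≢ 0# → g x ≢ 0#) (n : ℕ)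
    (fibre : ∀ x → ∃ λ zs → length zs ≤ n × (∀ {z} → g z ≡ g x → z ∈ zs)) where

    _~_ : Carrier → Carrier → Set
    c ~ c′ = ∃ λ x → ∃ λ x′ → x ≢ 0# × x′ ≢ 0# × c * g x ≡ c′ * g x′

    ~-sym : Symmetric _~_
    ~-sym (x , x′ , x≢0 , x′≢0 , eq) = x′ , x , x′≢0 , x≢0 , sym eq

    coset-bound : ∀ cs → All (_≢ 0#) cs → AllPairs (λ c c′ → ¬ (c ~ c′)) cs → length cs ≤ n
    coset-bound cs cs≢0 disjoint =
      -- The number of cosets times the number of nonzero elements is at most n times the latter,
      -- which is then cancelled.
      ℕ.*-cancelʳ-≤ _ _ (length nonzeros) ⦃ nonEmpty ⦄ (ℕ.≤-trans
        (ℕ.≤-reflexive (sym (length-cartesianProduct cs nonzeros)))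
        (ℕ.≤-trans (fibres≤⇒length≤ f _≟_ n cs×nz! fibre′ into) (ℕ.≤-reflexive (ℕ.*-comm (length nonzeros) n))))
      where
      f : Carrier × Carrier → Carrier
      f (c , x) = c * g x
      nonEmpty : ℕ.NonZero (length nonzeros)
      nonEmpty with nonzeros | ∈-nonzeros⁺ nonzero-1
      ... | _ ∷ _ | _ = _
      cs! : Unique cs
      -- Every c is related to itself through x = x′ = 1, so disjoint cosets have distinct
      -- representatives.
      cs! = AllPairs.map (λ { ¬~ refl → ¬~ (1# , 1# , nonzero-1 , nonzero-1 , refl) }) disjoint
      cs×nz! = Unique.cartesianProduct⁺ cs! (Unique.filter⁺ _ unique)
      into : ∀ {p} → p ∈ cartesianProduct cs nonzeros → f p ∈ nonzeros
      into p∈ = let c∈ , x∈ = ∈-cartesianProduct⁻ cs nonzeros p∈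
                in ∈-nonzeros⁺ (*-nonzero (All.lookup cs≢0 c∈) (g-nonzero (∈-nonzeros⁻ x∈)))
      fibre′ : ∀ {p} → p ∈ cartesianProduct cs nonzeros → ∃ λ zs → length zs ≤ n ×
               (∀ {q} → q ∈ cartesianProduct cs nonzeros → f q ≡ f p → q ∈ zs)
      fibre′ {c , x} p∈ with zs , zs≤n , sub ← fibre x =
        map (c ,_) zs , subst (_≤ n) (sym (length-map (c ,_) zs)) zs≤n , sub′
        where
        c∈ = proj₁ (∈-cartesianProduct⁻ cs nonzeros p∈)
        x≢0 = ∈-nonzeros⁻ (proj₂ (∈-cartesianProduct⁻ cs nonzeros p∈))
        sub′ : ∀ {q} → q ∈ cartesianProduct cs nonzeros → f q ≡ f (c , x) → q ∈ map (c ,_) zs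
        sub′ {c′ , z} q∈ eq with c′∈ , z∈ ← ∈-cartesianProduct⁻ cs nonzeros q∈
          with refl ← AllPairs-¬⇒≡ ~-sym disjoint c′∈ c∈ (z , x , ∈-nonzeros⁻ z∈ , x≢0 , eq)
          = ∈-map⁺ (c ,_) (sub (*-cancelˡ (All.lookup cs≢0 c∈) eq))

  -- Otherwise 1, a and b would represent three disjoint cosets of the nonzero squares, while
  -- squaring is at most two-to-one.
  nonsquare-* : ∀ {a b} → a ≢ 0# → b ≢ 0# → ¬ IsSquare a → ¬ IsSquare b → IsSquare (a * b)
  nonsquare-* {a} {b} a≢0 b≢0 ¬a ¬b with isSquare? (a * b)
  ... | yes sq = sq
  ... | no ¬ab = contradiction
      (coset-bound (1# ∷ a ∷ b ∷ []) (nonzero-1 ∷ a≢0 ∷ b≢0 ∷ [])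
        ((1≁a ¬a ∷ 1≁a ¬b ∷ []) ∷ (a≁b ∷ []) ∷ [] ∷ []))
      λ { (s≤s (s≤s ())) }
    where
    open Cosets (λ x → x * x) (λ x≢0 → *-nonzero x≢0 x≢0) 2
      (λ x → x ∷ - x ∷ [] , ℕ.≤-refl , λ eq → [ here , there ∘ here ]′ (x²≡y²⇒x≡±y eq))
    1≁a : ∀ {a} → ¬ IsSquare a → ¬ (1# ~ a)
    1≁a ¬a (x , y , _ , y≢0 , eq) =
      ¬a (IsSquare-cancel y≢0 (x , trans (sym (*-identityˡ _)) eq))
    a≁b : ¬ (a ~ b)
    a≁b (x , y , _ , y≢0 , eq) = ¬ab (IsSquare-cancel y≢0 (a * x ,
      mod a eq (solve 4 (λ a b x y →
          a :* x :* (a :* x)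
            :+ a :* (b :* (y :* y)) :=
          a :* b :* (y :* y)
            :+ a :* (a :* (x :* x))) refl a b x y)))

  same-square⇒* : ∀ {a b} → a ≢ 0# → b ≢ 0# → (IsSquare a → IsSquare b) → (IsSquare b → IsSquare a) →
    IsSquare (a * b)
  same-square⇒* {a} {b} a≢0 b≢0 a⇒b b⇒a with isSquare? a
  ... | yes a² = IsSquare-* a² (a⇒b a²)
  ... | no ¬a² = nonsquare-* a≢0 b≢0 ¬a² (¬a² ∘ b⇒a)

  -- x² + xy + y² = 0 makes (2x + y) / y a square root of −3.
  cube-injective : ¬ IsSquare (- # 3) → ∀ {x y} → x * x * x ≡ y * y * y → x ≡ y
  cube-injective ¬-3 {x} {y} eq with integral-⊎ {x - y} {x * x + x * y + y * y}
    (mod (# 1) eq (solve 2 (λ x y →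
        (x :- y) :* (x :* x :+ x :* y :+ y :* y)
          :+ con (+ 1) :* (y :* y :* y) :=
        con (+ 0)
          :+ con (+ 1) :* (x :* x :* x)) refl x y))
  ... | inj₁ x-y≡0 = mod-zero x-y≡0
  ... | inj₂ q with y ≟ 0#
  ...   | no y≢0 = contradiction (IsSquare-cancel y≢0 (# 2 * x + y ,
            mod (# 4) q (solve 2 (λ x y →
                (con (+ 2) :* x :+ y) :* (con (+ 2) :* x :+ y)
                  :+ con (+ 4) :* (con (+ 0)) :=
                :- (con (+ 3)) :* (y :* y)
                  :+ con (+ 4) :* (x :* x :+ x :* y :+ y :* y)) refl x y))) ¬-3
  ...   | yes refl with x ≟ 0#
  ...     | yes x≡0 = x≡0
  ...     | no x≢0 = contradiction (trans (solve 1 (λ x →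
      x :* x :=
      x :* x :+ x :* (con (+ 0)) :+ con (+ 0) :* (con (+ 0))) refl x) q) (*-nonzero x≢0 x≢0)

  cube-surjective : ¬ IsSquare (- # 3) → ∀ a → IsCube a
  cube-surjective ¬-3 a with injectiveOn⇒surjectiveOn (λ x → x * x * x) _≟_ unique
    (λ _ _ → cube-injective ¬-3) (λ _ → complete _) ℕ.≤-refl (complete a)
  ... | t , _ , eq = t , sym eq

  module CubeRoot (ω : Carrier) (ω-root : ω * ω + ω + 1# ≡ 0#) (3≢0 : # 3 ≢ 0#) where

    roots : Carrier → List Carrier
    roots x = x ∷ ω * x ∷ ω * ω * x ∷ []

    cube-roots : ∀ {x z} → z * z * z ≡ x * x * x → z ∈ roots x
    cube-roots {x} {z} eq =
      [ here ∘ mod-zero , [ there ∘ here ∘ mod-zero , there ∘ there ∘ here ∘ mod-zero ]′ ∘ integral-⊎ ]′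
        (integral-⊎ {z - x} {(z - ω * x) * (z - ω * ω * x)} factors)
      where
      factors : (z - x) * ((z - ω * x) * (z - ω * ω * x)) ≡ 0#
      factors = mod (# 1) eq (mod ((z - x) * ((ω - # 1) * x * x - x * z)) ω-root (solve 3 (λ ω x z →
          (z :- x) :* ((z :- ω :* x) :* (z :- ω :* ω :* x))
            :+ con (+ 1) :* (x :* x :* x)
            :+ (z :- x) :* ((ω :- con (+ 1)) :* x :* x :- x :* z) :* (con (+ 0)) :=
          con (+ 0)
            :+ con (+ 1) :* (z :* z :* z)
            :+ (z :- x) :* ((ω :- con (+ 1)) :* x :* x :- x :* z) :* (ω :* ω :+ ω :+ con (+ 1))) refl ω x z))

    roots-cube : ∀ {x z} → z ∈ roots x → z * z * z ≡ x * x * x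
    roots-cube (here refl) = refl
    roots-cube {x} (there (here refl)) =
      mod ((ω - # 1) * x * x * x) ω-root (solve 2 (λ ω x →
          ω :* x :* (ω :* x) :* (ω :* x)
            :+ (ω :- con (+ 1)) :* x :* x :* x :* (con (+ 0)) :=
          x :* x :* x
            :+ (ω :- con (+ 1)) :* x :* x :* x :* (ω :* ω :+ ω :+ con (+ 1))) refl ω x)
    roots-cube {x} (there (there (here refl))) =
      mod ((ω - # 1) * (ω * ω * ω + # 1) * x * x * x) ω-root (solve 2 (λ ω x →
          ω :* ω :* x :* (ω :* ω :* x) :* (ω :* ω :* x)
            :+ (ω :- con (+ 1)) :* (ω :* ω :* ω :+ con (+ 1)) :* x :* x :* x :* (con (+ 0)) :=
          x :* x :* x
            :+ (ω :- con (+ 1)) :* (ω :* ω :* ω :+ con (+ 1))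
                :* x :* x :* x :* (ω :* ω :+ ω :+ con (+ 1))) refl ω x)

    ω≢1 : ω ≢ 1#
    ω≢1 refl = 3≢0 (trans (solve 0 (con (+ 3) := con (+ 1) :* (con (+ 1)) :+ con (+ 1) :+ con (+ 1)) refl) ω-root)

    ω≢0 : ω ≢ 0#
    ω≢0 refl = nonzero-1 (trans (solve 0 (con (+ 1) := con (+ 0) :* (con (+ 0)) :+ con (+ 0) :+ con (+ 1)) refl) ω-root)

    ω²≢1 : ω * ω ≢ 1#
    ω²≢1 eq = ω≢1 (mod (ω - # 1) ω-root (mod (- ω) eq (solve 1 (λ ω →
        ω
          :+ (ω :- con (+ 1)) :* (con (+ 0))
          :+ :- ω :* (con (+ 1)) :=
        con (+ 1)
          :+ (ω :- con (+ 1)) :* (ω :* ω :+ ω :+ con (+ 1))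
          :+ :- ω :* (ω :* ω)) refl ω)))

    roots-unique : ∀ {x} → x ≢ 0# → Unique (roots x)
    roots-unique {x} x≢0 =
      ((λ eq → ω≢1 (cancel (trans (*-comm x ω) (trans (sym eq) (sym (*-identityʳ x)))))) ∷
       (λ eq → ω²≢1 (cancel (trans (*-comm x (ω * ω)) (trans (sym eq) (sym (*-identityʳ x)))))) ∷ []) ∷
      ((λ eq → ω≢1 (*-cancelˡ (*-nonzero ω≢0 x≢0)
        (mod (- # 1) eq (solve 2 (λ ω x →
            ω :* x :* ω
              :+ :- (con (+ 1)) :* (ω :* ω :* x) :=
            ω :* x :* (con (+ 1))
              :+ :- (con (+ 1)) :* (ω :* x)) refl ω x)))) ∷ []) ∷
      [] ∷ []
      where
      cancel : ∀ {a b} → x * a ≡ x * b → a ≡ b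
      cancel = *-cancelˡ x≢0

    -- Otherwise 1, a, a² and b would represent four disjoint cosets of the nonzero cubes, while
    -- cubing is at most three-to-one. Modulo cubes the two outcomes say that b is the inverse of a,
    -- or a itself.
    noncubes : ∀ {a b} → a ≢ 0# → b ≢ 0# → ¬ IsCube a → ¬ IsCube b → IsCube (b * a) ⊎ IsCube (b * (a * a))
    noncubes {a} {b} a≢0 b≢0 ¬a ¬b with isCube? (b * a) | isCube? (b * (a * a))
    ... | yes cu | _ = inj₁ cu
    ... | no _ | yes cu = inj₂ cu
    ... | no ¬ba | no ¬baa = contradiction
        (coset-bound (1# ∷ a ∷ a * a ∷ b ∷ []) (nonzero-1 ∷ a≢0 ∷ *-nonzero a≢0 a≢0 ∷ b≢0 ∷ [])
          ((1≁ ¬a ∷ 1≁ ¬aa ∷ 1≁ ¬b ∷ []) ∷ (a≁aa ∷ a≁b ∷ []) ∷ (aa≁b ∷ []) ∷ [] ∷ []))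
        λ { (s≤s (s≤s (s≤s ()))) }
      where
      open Cosets (λ x → x * x * x) (λ x≢0 → *-nonzero (*-nonzero x≢0 x≢0) x≢0) 3
        (λ x → roots x , ℕ.≤-refl , cube-roots)
      1≁ : ∀ {c} → ¬ IsCube c → ¬ (1# ~ c)
      1≁ ¬c (x , y , _ , y≢0 , eq) = ¬c (IsCube-cancel y≢0 (x , trans (sym (*-identityˡ _)) eq))
      ¬aa : ¬ IsCube (a * a)
      ¬aa cu = ¬a (IsCube-cancel a≢0 (subst IsCube (solve 1 (λ a →
          a :* a :* (a :* a) :=
          a :* (a :* a :* a)) refl a) (IsCube-* cu cu)))
      a≁aa : ¬ (a ~ (a * a))
      a≁aa (x , y , _ , y≢0 , eq) = ¬a (IsCube-cancel y≢0 (x ,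
        *-cancelˡ a≢0 (mod (# 1) eq (solve 3 (λ a x y →
            a :* (x :* x :* x)
              :+ con (+ 1) :* (a :* a :* (y :* y :* y)) :=
            a :* (a :* (y :* y :* y))
              :+ con (+ 1) :* (a :* (x :* x :* x))) refl a x y))))
      a≁b : ¬ (a ~ b)
      a≁b (x , y , _ , y≢0 , eq) = ¬baa (IsCube-cancel y≢0 (a * x ,
        mod (a * a) eq (solve 4 (λ a b x y →
            a :* x :* (a :* x) :* (a :* x)
              :+ a :* a :* (b :* (y :* y :* y)) :=
            b :* (a :* a) :* (y :* y :* y)
              :+ a :* a :* (a :* (x :* x :* x))) refl a b x y)))
      aa≁b : ¬ ((a * a) ~ b)
      aa≁b (x , y , _ , y≢0 , eq) = ¬ba (IsCube-cancel y≢0 (a * x ,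
        mod a eq (solve 4 (λ a b x y →
            a :* x :* (a :* x) :* (a :* x)
              :+ a :* (b :* (y :* y :* y)) :=
            b :* a :* (y :* y :* y)
              :+ a :* (a :* a :* (x :* x :* x))) refl a b x y)))

  -- Point counts modulo 2 and modulo 3.

  module PointCount (2≢0 : # 2 ≢ 0#) where
    open Curve F
    open AffineMaps F using (affineOnCurve?; plane; plane-unique; plane-complete)

    count-square-roots : ∀ {c} → c ≢ 0# → IsSquare c → length (filter (λ y → (y * y) ≟ c) elements) ≡ 2
    count-square-roots c≢0 (t , refl) = count (λ y → (y * y) ≟ (t * t)) (t ∷ - t ∷ [])
      ((x≢-x 2≢0 (λ { refl → c≢0 (zeroʳ _) }) ∷ []) ∷ [] ∷ [])
      (λ eq → [ here , there ∘ here ]′ (x²≡y²⇒x≡±y eq))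
      λ { (here refl) → refl ; (there (here refl)) → solve 1 (λ t →
          :- t :* (:- t) :=
          t :* t) refl t }

    count-0 : {P : Carrier → Set} (P? : Decidable P) → ¬ ∃ P → length (filter P? elements) ≡ 0
    count-0 P? ¬P = count P? [] [] (λ pz → contradiction (_ , pz) ¬P) λ ()

    count-1 : {P : Carrier → Set} (P? : Decidable P) → P 0# → (∀ {z} → P z → z ≡ 0#) →
      length (filter P? elements) ≡ 1
    count-1 P? p0 P⇒0 = count P? (0# ∷ []) ([] ∷ []) (here ∘ P⇒0) λ { (here refl) → p0 }

    x²≡0⇒x≡0 : ∀ {x} → x * x ≡ 0# → x ≡ 0#
    x²≡0⇒x≡0 eq = [ id , id ]′ (integral-⊎ eq)

    -- The exceptional x are the roots of x³ + B, each carrying the single point (x , 0); any other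
    -- x carries two points or none.
    #E-mod-2 : ∀ B → ∃ λ m → #E B ≡ suc (length (filter (λ x → (x * x * x + B) ≟ 0#) elements) ℕ.+ 2 ℕ.* m)
    #E-mod-2 B =
      let m , eq = count-pairs (affineOnCurve? B) (λ x → (x * x * x + B) ≟ 0#)
                     2 elements elements one even
      in m , cong suc eq
      where
      one : ∀ x → x * x * x + B ≡ 0# → length (filter (onCurve? B x) elements) ≡ 1
      one x root = count-1 (onCurve? B x) (trans (zeroʳ 0#) (sym root)) (λ on → x²≡0⇒x≡0 (trans on root))
      even : ∀ x → x * x * x + B ≢ 0# → ∃ λ m → length (filter (onCurve? B x) elements) ≡ 2 ℕ.* m
      even x c≢0 with isSquare? (x * x * x + B)
      ... | yes sq = 1 , count-square-roots c≢0 sq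
      ... | no ¬sq = 0 , count-0 (onCurve? B x) ¬sq

    -- `count-pairs` groups by the first coordinate, so grouping by y requires the coordinates to be
    -- exchanged.
    plane-swap : ∀ B → length (filter (affineOnCurve? B) plane) ≡
                       length (filter (affineOnCurve? B ∘ swap) plane)
    plane-swap B = trans
      (Unique-≡-length (Unique.filter⁺ _ plane-unique)
        (Unique.map⁺ (λ { refl → refl }) (Unique.filter⁺ _ plane-unique))
        ⊆₁ ⊆₂)
      (length-map swap (filter swapped? plane))
      where
      swapped? = affineOnCurve? B ∘ swap
      ⊆₁ : ∀ {P} → P ∈ filter (affineOnCurve? B) plane → P ∈ map swap (filter swapped? plane)
      ⊆₁ {P} P∈ = ∈-map⁺ swap (∈-filter⁺ swapped? (plane-complete (swap P))
        (proj₂ (∈-filter⁻ (affineOnCurve? B) {xs = plane} P∈)))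
      ⊆₂ : ∀ {P} → P ∈ map swap (filter swapped? plane) → P ∈ filter (affineOnCurve? B) plane
      ⊆₂ P∈ with Q , Q∈ , refl ← ∈-map⁻ swap P∈ =
        ∈-filter⁺ (affineOnCurve? B) (plane-complete (swap Q)) (proj₂ (∈-filter⁻ swapped? {xs = plane} Q∈))

    module _ (ω : Carrier) (ω-root : ω * ω + ω + 1# ≡ 0#) (3≢0 : # 3 ≢ 0#) where
      open CubeRoot ω ω-root 3≢0

      count-cube-roots : ∀ {P : Carrier → Set} (P? : Decidable P) {c} → c ≢ 0# → IsCube c →
        (∀ {z} → P z → z * z * z ≡ c) → (∀ {z} → z * z * z ≡ c → P z) → length (filter P? elements) ≡ 3
      count-cube-roots P? c≢0 (t , refl) P⇒ ⇒P = count P? (roots t)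
        (roots-unique (λ { refl → c≢0 (zeroʳ _) })) (cube-roots ∘ P⇒) (⇒P ∘ roots-cube)

      x³≡0⇒x≡0 : ∀ {x} → x * x * x ≡ 0# → x ≡ 0#
      x³≡0⇒x≡0 eq = [ x²≡0⇒x≡0 , id ]′ (integral-⊎ eq)

      -- The exceptional y are the square roots of B, each carrying only x = 0. For any other y the
      -- cube roots of y² - B are three, or there is none.
      #E-mod-3 : ∀ B → ∃ λ m → #E B ≡ suc (length (filter (λ y → (y * y) ≟ B) elements) ℕ.+ 3 ℕ.* m)
      #E-mod-3 B =
        let m , eq = count-pairs (affineOnCurve? B ∘ swap) (λ y → (y * y) ≟ B)
                       3 elements elements one triple
        in m , cong suc (trans (plane-swap B) eq)
        where
        to : ∀ {x y} → OnCurve B x y → x * x * x ≡ y * y - B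
        to {x} {y} on = mod (- # 1) on (solve 3 (λ B x y →
            x :* x :* x
              :+ :- (con (+ 1)) :* (x :* x :* x :+ B) :=
            y :* y :- B
              :+ :- (con (+ 1)) :* (y :* y)) refl B x y)
        from : ∀ {x y} → x * x * x ≡ y * y - B → OnCurve B x y
        from {x} {y} eq = mod (- # 1) eq (solve 3 (λ B x y →
            y :* y
              :+ :- (con (+ 1)) :* (y :* y :- B) :=
            x :* x :* x :+ B
              :+ :- (con (+ 1)) :* (x :* x :* x)) refl B x y)
        one : ∀ y → y * y ≡ B → length (filter (λ x → onCurve? B x y) elements) ≡ 1
        one y root = count-1 (λ x → onCurve? B x y) (from (trans (solve 0 (con (+ 0) :* (con (+ 0)) :* (con (+ 0)) := con (+ 0)) refl) (sym (sub-zero root))))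
          (λ on → x³≡0⇒x≡0 (trans (to on) (sub-zero root)))
        triple : ∀ y → y * y ≢ B → ∃ λ m → length (filter (λ x → onCurve? B x y) elements) ≡ 3 ℕ.* m
        triple y ≢B with isCube? (y * y - B)
        ... | yes cu = 1 , count-cube-roots (λ x → onCurve? B x y) (≢B ∘ mod-zero) cu to from
        ... | no ¬cu = 0 , count-0 (λ x → onCurve? B x y) (λ (x , on) → ¬cu (x , to on))

      -- A nonzero square has two exceptional fibres and a nonsquare has none, so the counts are 1 +
      -- 2 and 1 modulo 3; equality would make 3 divide 2.
      #E≡⇒square : ∀ {B₁ B₂} → B₁ ≢ 0# → #E B₁ ≡ #E B₂ → IsSquare B₁ → IsSquare B₂
      #E≡⇒square {B₁} {B₂} B₁≢0 #≡ sq with isSquare? B₂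
      ... | yes sq₂ = sq₂
      ... | no ¬sq =
        let m₁ , eq₁ = #E-mod-3 B₁
            m₂ , eq₂ = #E-mod-3 B₂
        in contradiction (∣-from-≡ 2 {m₁} {m₂}
             (residues≡ eq₁ (count-square-roots B₁≢0 sq) eq₂ (count-0 (λ y → (y * y) ≟ B₂) ¬sq) #≡))
             (Dec.from-no (3 ∣? 2))

      count-2-torsion : ∀ {B} → B ≢ 0# → IsCube B → length (filter (λ x → (x * x * x + B) ≟ 0#) elements) ≡ 3
      count-2-torsion {B} B≢0 (t , t³) = count-cube-roots (λ x → (x * x * x + B) ≟ 0#) (-‿nonzero B≢0)
        (- t , trans (solve 1 (λ t →
            :- t :* (:- t) :* (:- t) :=
            :- (t :* t :* t)) refl t) (cong -_ t³))
        (λ {x} eq → mod (# 1) eq (solve 2 (λ B x →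
            x :* x :* x
              :+ con (+ 1) :* (con (+ 0)) :=
            :- B
              :+ con (+ 1) :* (x :* x :* x :+ B)) refl B x))
        (λ {x} eq → mod (# 1) eq (solve 2 (λ B x →
            x :* x :* x :+ B
              :+ con (+ 1) :* (:- B) :=
            con (+ 0)
              :+ con (+ 1) :* (x :* x :* x)) refl B x))

      count-no-2-torsion : ∀ {B} → ¬ IsCube B → length (filter (λ x → (x * x * x + B) ≟ 0#) elements) ≡ 0
      count-no-2-torsion {B} ¬cu = count-0 (λ x → (x * x * x + B) ≟ 0#) (λ (x , eq) → ¬cu (- x ,
        (mod (- # 1) eq (solve 2 (λ B x →
            :- x :* (:- x) :* (:- x)
              :+ :- (con (+ 1)) :* (con (+ 0)) :=
            B
              :+ :- (con (+ 1)) :* (x :* x :* x :+ B)) refl B x))))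

      -- A nonzero cube gives three points (x , 0) and a noncube gives none, so the counts are 1 + 3
      -- and 1 modulo 2; equality would make 2 divide 3.
      #E≡⇒cube : ∀ {B₁ B₂} → B₁ ≢ 0# → #E B₁ ≡ #E B₂ → IsCube B₁ → IsCube B₂
      #E≡⇒cube {B₁} {B₂} B₁≢0 #≡ cu with isCube? B₂
      ... | yes cu₂ = cu₂
      ... | no ¬cu =
        let m₁ , eq₁ = #E-mod-2 B₁
            m₂ , eq₂ = #E-mod-2 B₂
        in contradiction (∣-from-≡ 3 {m₁} {m₂}
             (residues≡ eq₁ (count-2-torsion B₁≢0 cu) eq₂ (count-no-2-torsion ¬cu) #≡))
             (Dec.from-no (2 ∣? 3))

-- Isomorphisms from the square and cube classes of B₁ and B₂.

module Classification (F : FiniteField)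
  (2≢0 : Field.# F 2 ≢ FiniteField.0# F) (3≢0 : Field.# F 3 ≢ FiniteField.0# F) where
  open FiniteField F
  open Field F
  open Curve F
  open AffineMaps F
  open Secants F
  open Frobenius F
  open Twist F
  open Residues F
  open PointCount 2≢0

  sextic-twist : ∀ (s : Endomorphism) {B₁ B₂} → B₁ ≢ 0# → B₂ ≢ 0# →
    IsSquare (B₂ * Endomorphism.σ s B₁) → IsCube (B₂ * (Endomorphism.σ s B₁ * Endomorphism.σ s B₁)) →
    AffineHom B₁ B₂
  sextic-twist s B₁≢0 B₂≢0 sq cu =
    let u , u≢0 , eq = sixth-power-multiple (Endomorphism.σ-nonzero s B₁≢0) B₂≢0 sq cu
    in twist s u≢0 eq

  module _ (¬-3 : ¬ IsSquare (- # 3)) where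

    nonsquare→any : ∀ {B₁ B₂} → B₁ ≢ 0# → B₂ ≢ 0# → ¬ IsSquare B₁ → AffineHom B₁ B₂
    nonsquare→any {B₁} {B₂} B₁≢0 B₂≢0 ¬sq₁ with isSquare? B₂
    ... | no ¬sq₂ = sextic-twist identity B₁≢0 B₂≢0 (nonsquare-* B₂≢0 B₁≢0 ¬sq₂ ¬sq₁) (cube-surjective ¬-3 _)
    ... | yes sq₂ = sextic-twist identity B′≢0 B₂≢0 (IsSquare-* sq₂ B′-square) (cube-surjective ¬-3 _) ⊙ isogeny
      where
      open ThreeIsogeny F 2≢0 3≢0 B₁ ¬sq₁
      -- -27 B₁ = 3² · (-3 · B₁), and both -3 and B₁ are nonsquares.
      B′-square : IsSquare B′
      B′-square = subst IsSquare (solve 1 (λ b →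
          con (+ 3) :* (con (+ 3)) :* (:- (con (+ 3)) :* b) :=
          :- (con (+ 27) :* b)) refl B₁)
        (IsSquare-* (# 3 , refl) (nonsquare-* (-‿nonzero 3≢0) B₁≢0 ¬-3 ¬sq₁))
      B′≢0 : B′ ≢ 0#
      B′≢0 = -‿nonzero (*-nonzero 27≢0 B₁≢0)
        where
        27≢0 : # 27 ≢ 0#
        27≢0 eq = *-nonzero (*-nonzero 3≢0 3≢0) 3≢0 (trans (solve 0 (con (+ 3) :* (con (+ 3)) :* (con (+ 3)) := con (+ 27)) refl) eq)

    iso-without-ω : ∀ {B₁ B₂} → B₁ ≢ 0# → B₂ ≢ 0# → #E B₁ ≡ #E B₂ → GroupIso B₁ B₂
    iso-without-ω {B₁} {B₂} B₁≢0 B₂≢0 #≡ with isSquare? B₁ | isSquare? B₂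
    ... | no ¬sq₁  | _        = AffineHom⇒GroupIso #≡ (nonsquare→any B₁≢0 B₂≢0 ¬sq₁)
    ... | yes sq₁  | no ¬sq₂  = GroupIso-sym (AffineHom⇒GroupIso (sym #≡) (nonsquare→any B₂≢0 B₁≢0 ¬sq₂))
    ... | yes sq₁  | yes sq₂  = AffineHom⇒GroupIso #≡
            (sextic-twist identity B₁≢0 B₂≢0 (IsSquare-* sq₂ sq₁) (cube-surjective ¬-3 _))

  module _ (ω : Carrier) (ω-root : ω * ω + ω + 1# ≡ 0#)
    (s : Endomorphism)
    (σ-square : ∀ x → IsSquare (Endomorphism.σ s x * x))
    (σ-cube : ∀ x → IsCube (Endomorphism.σ s x * x)) where
    open Endomorphism s
    open CubeRoot ω ω-root 3≢0

    iso-with-ω : ∀ {B₁ B₂} → B₁ ≢ 0# → B₂ ≢ 0# → #E B₁ ≡ #E B₂ → GroupIso B₁ B₂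
    iso-with-ω {B₁} {B₂} B₁≢0 B₂≢0 #≡ = AffineHom⇒GroupIso #≡ hom
      where
      square : IsSquare (B₂ * B₁)
      square = same-square⇒* B₂≢0 B₁≢0 (#E≡⇒square ω ω-root 3≢0 B₂≢0 (sym #≡)) (#E≡⇒square ω ω-root 3≢0 B₁≢0 #≡)

      conjugate : IsCube (B₂ * B₁) → AffineHom B₁ B₂
      -- σ B₁ behaves as the inverse of B₁: B₂ σ B₁ is (B₂ B₁)(σ B₁ · B₁) up to B₁², and B₂ (σ B₁)²
      -- is (B₂ B₁)(σ B₁ · B₁)² up to B₁³.
      conjugate cube = sextic-twist s B₁≢0 B₂≢0
        (IsSquare-cancel B₁≢0 (subst IsSquare (solve 3 (λ a b c →
            b :* a :* (c :* a) :=
            b :* c :* (a :* a)) refl B₁ B₂ (σ B₁))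
          (IsSquare-* square (σ-square B₁))))
        (IsCube-cancel B₁≢0 (subst IsCube (solve 3 (λ a b c →
            b :* a :* (c :* a :* (c :* a)) :=
            b :* (c :* c) :* (a :* a :* a)) refl B₁ B₂ (σ B₁))
          (IsCube-* cube (IsCube-* (σ-cube B₁) (σ-cube B₁)))))

      hom : AffineHom B₁ B₂
      hom with isCube? B₁
      ... | yes cu₁ = sextic-twist identity B₁≢0 B₂≢0 square
              (IsCube-* (#E≡⇒cube ω ω-root 3≢0 B₁≢0 #≡ cu₁) (IsCube-* cu₁ cu₁))
      ... | no ¬cu₁ = [ conjugate , sextic-twist identity B₁≢0 B₂≢0 square ]′
              (noncubes B₁≢0 B₂≢0 ¬cu₁ (¬cu₁ ∘ #E≡⇒cube ω ω-root 3≢0 B₂≢0 (sym #≡)))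

  -- The quadratic formula: -3 is the discriminant of ω² + ω + 1, and ω = (s - 1) / 2.
  √-3⇒ω : ∀ {s} → s * s ≡ - # 3 → ∃ λ ω → ω * ω + ω + 1# ≡ 0#
  √-3⇒ω {s} s² = ω , *-cancelˡ (*-nonzero 2≢0 2≢0) (begin
    # 2 * # 2 * (ω * ω + ω + 1#)                         ≡⟨ solve 1 (λ w →
        con (+ 2) :* (con (+ 2)) :* (w :* w :+ w :+ con (+ 1)) :=
        con (+ 2) :* w :* (con (+ 2) :* w) :+ con (+ 2) :* (con (+ 2) :* w) :+ con (+ 4)) refl ω ⟩
    # 2 * ω * (# 2 * ω) + # 2 * (# 2 * ω) + # 4          ≡⟨ cong (λ z → z * z + # 2 * z + # 4) (*-/ 2≢0 (s - 1#)) ⟩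
    (s - 1#) * (s - 1#) + # 2 * (s - 1#) + # 4           ≡⟨ mod (# 1) s² (solve 1 (λ s →
        (s :- con (+ 1)) :* (s :- con (+ 1)) :+ con (+ 2) :* (s :- con (+ 1)) :+ con (+ 4)
          :+ con (+ 1) :* (:- (con (+ 3))) :=
        con (+ 2) :* (con (+ 2)) :* (con (+ 0))
          :+ con (+ 1) :* (s :* s)) refl s) ⟩
    # 2 * # 2 * 0#                                       ∎)
    where
    open ≡-Reasoning
    ω = (s - 1#) / # 2

theorem4p8 : (p k : ℕ) → Prime p → p > 3 → p % 3 ≡ 2 →
    (F : FiniteField) → FiniteField.size F ≡ p ^ k →
    (B₁ B₂ : FiniteField.Carrier F) →
    B₁ ≢ FiniteField.0# F → B₂ ≢ FiniteField.0# F →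
    (Curve.#E F B₁ ≡ Curve.#E F B₂) ⇔ Curve._≅E_ F B₁ B₂
theorem4p8 p k pr p>3 p%3≡2 F size≡ B₁ B₂ B₁≢0 B₂≢0 = mk⇔ iso GroupIso⇒#E≡
  where
  open FiniteField F
  open Curve F
  open Field F
  open AffineMaps F
  open Frobenius F
  open Residues F

  #p≡0 : # p ≡ 0#
  #p≡0 = #^≡0⇒#≡0 p k (subst (λ n → # n ≡ 0#) size≡ #size≡0)

  odd : ∃ λ s → p ≡ 1 ℕ.+ s ℕ.* 2
  odd = prime>3⇒odd pr p>3

  2-mod-3 : ∃ λ s → p ≡ 2 ℕ.+ s ℕ.* 3
  2-mod-3 = p ℕ./ 3 , trans (m≡m%n+[m/n]*n p 3) (cong (ℕ._+ p ℕ./ 3 ℕ.* 3) p%3≡2)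

  -- This excludes characteristics 2 and 3. As p vanishes in F, so would its remainder modulo any n
  -- that vanishes: 2 = 0 would give 1 = 0 because p is odd, and 3 = 0 would give 2 = 0 because p is
  -- 2 modulo 3.
  remainder≡0 : ∀ {r s n} → p ≡ r ℕ.+ s ℕ.* n → # n ≡ 0# → # r ≡ 0#
  remainder≡0 {r} {s} {n} p≡ #n≡0 = begin
    # r                  ≡⟨ +-identityʳ (# r) ⟨
    # r + 0#             ≡⟨ cong (λ z → # r + z) (trans (#-* s n) (trans (cong (# s *_) #n≡0) (zeroʳ (# s)))) ⟨
    # r + # (s ℕ.* n)    ≡⟨ #-+ r (s ℕ.* n) ⟨
    # (r ℕ.+ s ℕ.* n)    ≡⟨ cong # p≡ ⟨
    # p                  ≡⟨ #p≡0 ⟩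
    0#                   ∎
    where open ≡-Reasoning

  2≢0 : # 2 ≢ 0#
  2≢0 #2≡0 = nonzero-1 (remainder≡0 {1} {proj₁ odd} (proj₂ odd) #2≡0)

  3≢0 : # 3 ≢ 0#
  3≢0 #3≡0 = 2≢0 (remainder≡0 {2} {proj₁ 2-mod-3} (proj₂ 2-mod-3) #3≡0)

  open Classification F 2≢0 3≢0

  iso : #E B₁ ≡ #E B₂ → B₁ ≅E B₂
  iso #≡ with isSquare? (- # 3)
  ... | no ¬-3 = iso-without-ω ¬-3 B₁≢0 B₂≢0 #≡
  ... | yes (s , s²) = let ω , ω-root = √-3⇒ω s² in iso-with-ω ω ω-root (frobenius pr #p≡0)
      (odd-power-* (proj₁ odd) (proj₂ odd))
      (2-mod-3-power-* (proj₁ 2-mod-3) (proj₂ 2-mod-3)) B₁≢0 B₂≢0 #≡
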